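{- For each finite nonempty set $V$ let $\mathrm{MG}[V]$ be the $\mathbb{K}$-vector space with basis the multigraphs on $V$ (and $\mathrm{MG}[\emptyset]=\{0\}$). For disjoint finite sets $V_1,V_2$ with $V_2$ nonempty, $*\notin V_1\sqcup V_2$, and multigraphs $g_1$ on $V_1\sqcup\{*\}$ and $g_2$ on $V_2$, define $g_1\circ_* g_2$ as the sum (with multiplicity) over all multigraphs obtained as follows: take the disjoint union of $g_1$ and $g_2$; remove the vertex $*$ from $g_1$; reconnect each edge end that was attached to $*$ to any vertex of $V_2$, independently for each such end (a loop at $*$ has two such ends). That is, if $m$ is the number of edge ends attached to $*$ in $g_1$, $g_1\circ_*g_2$ is the sum over all $|V_2|^m$ maps from these ends to $V_2$ of the resulting multigraph on $V_1\sqcup V_2$. Extend bilinearly. Then the species $\mathrm{MG}$ endowed with this partial composition (with units the edgeless graph on $\{v\}$) is an operad.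
   Context: $\mathbb{K}$ is a field of characteristic $0$. A (linear) species $S$ is a functor from finite sets with bijections to $\mathbb{K}$-vector spaces, $V\mapsto S[V]$, $\sigma\mapsto S[\sigma]$. An operad is a species $O$ with $O[\emptyset]=\{0\}$, units $e(v)\in O[\{v\}]$ (natural in $v$), and bilinear maps $\circ_*:O[V_1\sqcup\{*\}]\times O[V_2]\to O[V_1\sqcup V_2]$ (partial compositions, for disjoint finite sets $V_1$, $V_2$ and $*\notin V_1\sqcup V_2$), natural with respect to bijections, such that (i) $(x\circ_{*_1}y)\circ_{*_2}z=(x\circ_{*_2}z)\circ_{*_1}y$ for $x\in O[V_1\sqcup\{*_1,*_2\}]$, $y\in O[V_2]$, $z\in O[V_3]$; (ii) $(x\circ_{*_1}y)\circ_{*_2}z=x\circ_{*_1}(y\circ_{*_2}z)$ for $x\in O[V_1\sqcup\{*_1\}]$, $y\in O[V_2\sqcup\{*_2\}]$, $z\in O[V_3]$; (iii) $x\circ_* e(v)=O[\sigma](x)$, where $\sigma$ sends $*$ to $v$ and is the identity elsewhere, and $e(*)\circ_* x=x$. A multigraph on $V$ is a finite multiset of unordered pairs $\{u,v\}$ of (possibly equal) elements of $V$, called edges; the two vertices of an edge are its two ends (a loop has two ends at the same vertex). -}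

module Defs where

open import Level using (Level; 0ℓ; suc; _⊔_)
open import Algebra.Apartness.Bundles using (HeytingField; HeytingCommutativeRing)
open import Algebra.Bundles using (CommutativeRing)
open import Algebra.Module.Bundles using (Module)
open import Algebra.Module.Morphism.Structures using (module ModuleMorphisms)
open import Algebra.Module.Structures.Biased using (module IsModuleFromLeft)
import Algebra.Properties.Monoid.Mult as Mult
import Algebra.Properties.AbelianGroup as AbelianGroupProperties
open import Data.Bool.Base using (if_then_else_)
open import Data.Empty using (⊥)
open import Data.Fin.Base using (Fin)
import Data.Fin.Properties as Fin
open import Data.List.Base using (List; []; _∷_; [_]; _++_; map; concatMap; cartesianProductWith; allFin)
import Data.List.Properties as List
open import Data.List.Relation.Unary.Any using (Any; here; there; any?; _─_)
import Data.List.Relation.Binary.Permutation.Setoid as Permutation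
import Data.List.Relation.Binary.Permutation.Setoid.Properties as PermutationProperties
open import Data.Nat.Base using (ℕ; _+_)
open import Data.Product.Base as Product using (_×_; _,_; proj₁; proj₂)
open import Data.Sum.Base as Sum using (_⊎_; inj₁; inj₂)
open import Data.Sum.Algebra using (⊎-cong; ⊎-assoc)
open import Data.Unit.Base using (⊤; tt)
open import Function.Base using (_∘_; id)
open import Function.Bundles using (_↔_; Inverse; mk↔ₛ′)
open import Function.Construct.Composition using (_↔-∘_)
open import Function.Construct.Identity using (↔-id)
open import Function.Construct.Symmetry using (↔-sym)
open import Function.Properties.Inverse using (↔⇒↣)
open import Relation.Binary.Bundles using (Setoid; DecSetoid)
open import Relation.Binary.Definitions using (DecidableEquality; Decidable)
import Relation.Binary.Construct.On as On
open import Relation.Binary.PropositionalEquality as ≡ using (_≡_)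
open import Relation.Nullary using (¬_; Dec; yes; no; does; contradiction; _×-dec_; _⊎-dec_)
open import Relation.Nullary.Decidable using (via-injection; map′)

record FinSet : Set₁ where
  -- Without η and with copattern definitions below, V ⊕ W does not unfold
  -- during unification, and finite sets can be left implicit.
  no-eta-equality
  field
    ⟨_⟩  : Set
    size : ℕ
    enum : ⟨_⟩ ↔ Fin size

open FinSet public using (⟨_⟩)

elements : (V : FinSet) → List ⟨ V ⟩
elements V = map (Inverse.from (FinSet.enum V)) (allFin (FinSet.size V))

≡-dec : (V : FinSet) → DecidableEquality ⟨ V ⟩
≡-dec V = via-injection (↔⇒↣ (FinSet.enum V)) Fin._≟_

∅ : FinSet
∅ .⟨_⟩         = ⊥
∅ .FinSet.size = 0
∅ .FinSet.enum = ↔-sym Fin.0↔⊥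

𝟙 : FinSet
𝟙 .⟨_⟩         = ⊤
𝟙 .FinSet.size = 1
𝟙 .FinSet.enum = ↔-sym Fin.1↔⊤

infixl 6 _⊕_

_⊕_ : FinSet → FinSet → FinSet
(V ⊕ W) .⟨_⟩         = ⟨ V ⟩ ⊎ ⟨ W ⟩
(V ⊕ W) .FinSet.size = FinSet.size V + FinSet.size W
(V ⊕ W) .FinSet.enum = ↔-sym Fin.+↔⊎ ↔-∘ ⊎-cong (FinSet.enum V) (FinSet.enum W)

infix 4 _≅_

-- A record, so that V and W can be inferred from a bijection.
record _≅_ (V W : FinSet) : Set where
  constructor bij
  field
    bijection : ⟨ V ⟩ ↔ ⟨ W ⟩
  open Inverse bijection public using (to; from)

open _≅_ public using (to; from)

≅-id : ∀ {V} → V ≅ V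
≅-id {V} = bij (↔-id ⟨ V ⟩)

infixr 9 _≅-∘_

_≅-∘_ : ∀ {U V W} → V ≅ W → U ≅ V → U ≅ W
bij τ ≅-∘ bij σ = bij (τ ↔-∘ σ)

infixr 6 _⊕-≅_

_⊕-≅_ : ∀ {V V′ W W′} → V ≅ V′ → W ≅ W′ → V ⊕ W ≅ V′ ⊕ W′
bij σ ⊕-≅ bij τ = bij (⊎-cong σ τ)

assocʳ : ∀ U V W → (U ⊕ V) ⊕ W ≅ U ⊕ (V ⊕ W)
assocʳ U V W = bij (⊎-assoc 0ℓ ⟨ U ⟩ ⟨ V ⟩ ⟨ W ⟩)

assocˡ : ∀ U V W → U ⊕ (V ⊕ W) ≅ (U ⊕ V) ⊕ W
assocˡ U V W = bij (↔-sym (⊎-assoc 0ℓ ⟨ U ⟩ ⟨ V ⟩ ⟨ W ⟩))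

exchange : ∀ U V W → (U ⊕ V) ⊕ W ≅ (U ⊕ W) ⊕ V
exchange U V W = bij (mk↔ₛ′ ex ex ex-ex ex-ex)
  where
  ex : ∀ {A B C : Set} → (A ⊎ B) ⊎ C → (A ⊎ C) ⊎ B
  ex (inj₁ (inj₁ a)) = inj₁ (inj₁ a)
  ex (inj₁ (inj₂ b)) = inj₂ b
  ex (inj₂ c)        = inj₁ (inj₂ c)

  ex-ex : ∀ {A B C : Set} (x : (A ⊎ B) ⊎ C) → ex (ex x) ≡ x
  ex-ex (inj₁ (inj₁ a)) = ≡.refl
  ex-ex (inj₁ (inj₂ b)) = ≡.refl
  ex-ex (inj₂ c)        = ≡.refl

⊕-identityˡ⁻¹ : ∀ V → V ≅ ∅ ⊕ V
⊕-identityˡ⁻¹ V = bij (mk↔ₛ′ inj₂ Sum.[ (λ ()) , id ] Sum.[ (λ ()) , (λ _ → ≡.refl) ] (λ _ → ≡.refl))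

IsOnlyElement : (V : FinSet) → ⟨ V ⟩ → Set
IsOnlyElement V v = ∀ w → w ≡ v

point : ∀ V v → IsOnlyElement V v → 𝟙 ≅ V
point V v only = bij (mk↔ₛ′ (λ _ → v) (λ _ → tt) (λ w → ≡.sym (only w)) (λ _ → ≡.refl))

private
  variable
    c ℓ₁ ℓ₂ : Level

fieldRing : HeytingField c ℓ₁ ℓ₂ → CommutativeRing c ℓ₁
fieldRing K = HeytingCommutativeRing.commutativeRing (HeytingField.heytingCommutativeRing K)

CharacteristicZero : HeytingField c ℓ₁ ℓ₂ → Set ℓ₁
CharacteristicZero K = ∀ n → (n · 1#) ≈ 0# → n ≡ 0
  where
  open CommutativeRing (fieldRing K)
  open Mult +-monoid renaming (_×_ to _·_)

IsLinear : ∀ {R : CommutativeRing c ℓ₁} {m₁ ℓm₁ m₂ ℓm₂}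
           (M : Module R m₁ ℓm₁) (N : Module R m₂ ℓm₂) →
           (Module.Carrierᴹ M → Module.Carrierᴹ N) → Set (c ⊔ m₁ ⊔ ℓm₁ ⊔ ℓm₂)
IsLinear M N = IsModuleHomomorphism
  where open ModuleMorphisms (Module.rawModule M) (Module.rawModule N)

record Species (K : HeytingField c ℓ₁ ℓ₂) (m ℓm : Level) : Set (suc (c ⊔ ℓ₁ ⊔ m ⊔ ℓm)) where
  field
    obj : FinSet → Module (fieldRing K) m ℓm

  Elem : FinSet → Set m
  Elem V = Module.Carrierᴹ (obj V)

  infix 4 _≈_
  _≈_ : ∀ {V} → Elem V → Elem V → Set ℓm
  _≈_ {V} = Module._≈ᴹ_ (obj V)

  field
    act        : ∀ {V W} → V ≅ W → Elem V → Elem W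
    act-linear : ∀ {V W} (σ : V ≅ W) → IsLinear (obj V) (obj W) (act σ)
    act-cong   : ∀ {V W} (σ τ : V ≅ W) → (∀ v → to σ v ≡ to τ v) →
                 ∀ x → act σ x ≈ act τ x
    act-id     : ∀ {V} (x : Elem V) → act ≅-id x ≈ x
    act-∘      : ∀ {U V W} (τ : V ≅ W) (σ : U ≅ V) (x : Elem U) →
                 act (τ ≅-∘ σ) x ≈ act τ (act σ x)

-- Disjoint unions V₁ ⊔ V₂ of finite sets are rendered by coproducts V₁ ⊕ V₂,
-- and an adjoined point * by the last summand of V ⊕ 𝟙.  The equalities between
-- iterated disjoint unions which are implicit in the usual notation for the
-- axioms become the action of the canonical bijections.
module _ {K : HeytingField c ℓ₁ ℓ₂} {m ℓm : Level} (S : Species K m ℓm) where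
  open Species S

  record IsOperad
    (unit : ∀ V v → IsOnlyElement V v → Elem V)
    (comp : ∀ V₁ V₂ → Elem (V₁ ⊕ 𝟙) → Elem V₂ → Elem (V₁ ⊕ V₂))
    : Set (suc 0ℓ ⊔ c ⊔ m ⊔ ℓm) where
    field
      empty-zero   : ∀ V → ¬ ⟨ V ⟩ → (x : Elem V) → x ≈ Module.0ᴹ (obj V)

      unit-natural : ∀ {V W} (σ : V ≅ W) v w v-only w-only →
                     act σ (unit V v v-only) ≈ unit W w w-only

      comp-linearˡ : ∀ {V₁ V₂} (y : Elem V₂) →
                     IsLinear (obj (V₁ ⊕ 𝟙)) (obj (V₁ ⊕ V₂)) (λ x → comp V₁ V₂ x y)
      comp-linearʳ : ∀ {V₁ V₂} (x : Elem (V₁ ⊕ 𝟙)) →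
                     IsLinear (obj V₂) (obj (V₁ ⊕ V₂)) (λ y → comp V₁ V₂ x y)

      comp-natural : ∀ {V₁ V₂ W₁ W₂} (σ : V₁ ≅ W₁) (τ : V₂ ≅ W₂)
                     (x : Elem (V₁ ⊕ 𝟙)) (y : Elem V₂) →
                     act (σ ⊕-≅ τ) (comp V₁ V₂ x y) ≈
                     comp W₁ W₂ (act (σ ⊕-≅ ≅-id) x) (act τ y)

      -- In V₁ ⊕ 𝟙 ⊕ 𝟙 the last point is *₁ and the other one is *₂.
      comp-parallel : ∀ {V₁ V₂ V₃} (x : Elem (V₁ ⊕ 𝟙 ⊕ 𝟙)) (y : Elem V₂) (z : Elem V₃) →
        comp (V₁ ⊕ V₂) V₃ (act (exchange V₁ 𝟙 V₂) (comp (V₁ ⊕ 𝟙) V₂ x y)) z ≈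
        act (exchange V₁ V₃ V₂)
          (comp (V₁ ⊕ V₃) V₂
            (act (exchange V₁ 𝟙 V₃) (comp (V₁ ⊕ 𝟙) V₃ (act (exchange V₁ 𝟙 𝟙) x) z))
            y)

      comp-sequential : ∀ {V₁ V₂ V₃} (x : Elem (V₁ ⊕ 𝟙)) (y : Elem (V₂ ⊕ 𝟙)) (z : Elem V₃) →
        act (assocʳ V₁ V₂ V₃)
          (comp (V₁ ⊕ V₂) V₃ (act (assocˡ V₁ V₂ 𝟙) (comp V₁ (V₂ ⊕ 𝟙) x y)) z) ≈
        comp V₁ (V₂ ⊕ V₃) x (comp V₂ V₃ y z)

      comp-unitʳ : ∀ {V₁ V} v (v-only : IsOnlyElement V v) (x : Elem (V₁ ⊕ 𝟙)) →
        comp V₁ V x (unit V v v-only) ≈ act (≅-id ⊕-≅ point V v v-only) x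

      comp-unitˡ : ∀ {V} *-only (x : Elem V) →
        comp ∅ V (unit (∅ ⊕ 𝟙) (inj₂ tt) *-only) x ≈ act (⊕-identityˡ⁻¹ V) x

-- Formal linear combinations of elements of B, two of them being equal when
-- every element of B has the same total coefficient in both.
module FreeModule (R : CommutativeRing c ℓ₁) (B : DecSetoid 0ℓ 0ℓ) where
  open CommutativeRing R renaming (Carrier to K; _+_ to _+ᴷ_)
  open DecSetoid B using (_≟_) renaming (Carrier to Basis; _≈_ to _≈ᴮ_)

  Comb : Set c
  Comb = List (K × Basis)

  select : ∀ {P : Set} → Dec P → K → K
  select d k = if does d then k else 0#

  coeff : Comb → Basis → K
  coeff []            b = 0#
  coeff ((k , a) ∷ x) b = select (a ≟ b) k +ᴷ coeff x b

  infix 4 _≈ᶜ_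
  -- A record, so that the combinations can be inferred from an equality.
  record _≈ᶜ_ (x y : Comb) : Set ℓ₁ where
    constructor by-coeff
    field coeff-≈ : ∀ b → coeff x b ≈ coeff y b

  open _≈ᶜ_ public

  infixr 7 _∙ᶜ_
  _∙ᶜ_ : K → Comb → Comb
  k ∙ᶜ x = map (Product.map₁ (k *_)) x

  -ᶜ_ : Comb → Comb
  -ᶜ x = map (Product.map₁ (λ k → - k)) x

  open import Relation.Binary.Reasoning.Setoid setoid
  open AbelianGroupProperties +-abelianGroup using (⁻¹-∙-comm; ε⁻¹≈ε)

  coeff-++ : ∀ x y b → coeff (x ++ y) b ≈ coeff x b +ᴷ coeff y b
  coeff-++ []            y b = sym (+-identityˡ _)
  coeff-++ ((k , a) ∷ x) y b =
    trans (+-congˡ (coeff-++ x y b)) (sym (+-assoc _ _ _))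

  coeff-∙ : ∀ k x b → coeff (k ∙ᶜ x) b ≈ k * coeff x b
  coeff-∙ k []            b = sym (zeroʳ k)
  coeff-∙ k ((l , a) ∷ x) b = trans (+-cong (go (a ≟ b)) (coeff-∙ k x b)) (sym (distribˡ _ _ _))
    where
    go : ∀ {P : Set} (d : Dec P) → select d (k * l) ≈ k * select d l
    go (yes _) = refl
    go (no _)  = sym (zeroʳ k)

  coeff-neg : ∀ x b → coeff (-ᶜ x) b ≈ - coeff x b
  coeff-neg []            b = sym ε⁻¹≈ε
  coeff-neg ((l , a) ∷ x) b = trans (+-cong (go (a ≟ b)) (coeff-neg x b)) (⁻¹-∙-comm _ _)
    where
    go : ∀ {P : Set} (d : Dec P) → select d (- l) ≈ - select d l
    go (yes _) = refl
    go (no _)  = sym ε⁻¹≈ε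

  freeModule : Module R c ℓ₁
  freeModule = record
    { Carrierᴹ = Comb
    ; _≈ᴹ_     = _≈ᶜ_
    ; _+ᴹ_     = _++_
    ; _*ₗ_     = _∙ᶜ_
    ; 0ᴹ       = []
    ; -ᴹ_      = -ᶜ_
    ; isModule = IsModuleFromLeft.isModule {commutativeRing = R} (record
      { isLeftModule = record
        { isLeftSemimodule = record
          { +ᴹ-isCommutativeMonoid = record
            { isMonoid = record
              { isSemigroup = record
                { isMagma = record
                  { isEquivalence = record
                    { refl  = by-coeff λ b → refl
                    ; sym   = λ p → by-coeff λ b → sym (coeff-≈ p b)
                    ; trans = λ p q → by-coeff λ b → trans (coeff-≈ p b) (coeff-≈ q b)
                    }
                  ; ∙-cong = λ {x} {y} {u} {v} p q → by-coeff λ b → begin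
                      coeff (x ++ u) b         ≈⟨ coeff-++ x u b ⟩
                      coeff x b +ᴷ coeff u b   ≈⟨ +-cong (coeff-≈ p b) (coeff-≈ q b) ⟩
                      coeff y b +ᴷ coeff v b   ≈⟨ coeff-++ y v b ⟨
                      coeff (y ++ v) b         ∎
                  }
                ; assoc = λ x y z → by-coeff λ b →
                    reflexive (≡.cong (λ t → coeff t b) (List.++-assoc x y z))
                }
              ; identity = (λ x → by-coeff λ b → refl)
                         , (λ x → by-coeff λ b →
                              reflexive (≡.cong (λ t → coeff t b) (List.++-identityʳ x)))
              }
            ; comm = λ x y → by-coeff λ b → begin
                coeff (x ++ y) b         ≈⟨ coeff-++ x y b ⟩
                coeff x b +ᴷ coeff y b   ≈⟨ +-comm _ _ ⟩
                coeff y b +ᴷ coeff x b   ≈⟨ coeff-++ y x b ⟨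
                coeff (y ++ x) b         ∎
            }
          ; isPreleftSemimodule = record
            { *ₗ-cong = λ {k} {l} {x} {y} k≈l p → by-coeff λ b → begin
                coeff (k ∙ᶜ x) b   ≈⟨ coeff-∙ k x b ⟩
                k * coeff x b      ≈⟨ *-cong k≈l (coeff-≈ p b) ⟩
                l * coeff y b      ≈⟨ coeff-∙ l y b ⟨
                coeff (l ∙ᶜ y) b   ∎
            ; *ₗ-zeroˡ = λ x → by-coeff λ b → trans (coeff-∙ 0# x b) (zeroˡ _)
            ; *ₗ-distribʳ = λ x k l → by-coeff λ b → begin
                coeff ((k +ᴷ l) ∙ᶜ x) b                  ≈⟨ coeff-∙ (k +ᴷ l) x b ⟩
                (k +ᴷ l) * coeff x b                     ≈⟨ distribʳ _ _ _ ⟩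
                k * coeff x b +ᴷ l * coeff x b           ≈⟨ +-cong (coeff-∙ k x b) (coeff-∙ l x b) ⟨
                coeff (k ∙ᶜ x) b +ᴷ coeff (l ∙ᶜ x) b     ≈⟨ coeff-++ (k ∙ᶜ x) (l ∙ᶜ x) b ⟨
                coeff ((k ∙ᶜ x) ++ (l ∙ᶜ x)) b           ∎
            ; *ₗ-identityˡ = λ x → by-coeff λ b → trans (coeff-∙ 1# x b) (*-identityˡ _)
            ; *ₗ-assoc = λ k l x → by-coeff λ b → begin
                coeff ((k * l) ∙ᶜ x) b    ≈⟨ coeff-∙ (k * l) x b ⟩
                (k * l) * coeff x b       ≈⟨ *-assoc _ _ _ ⟩
                k * (l * coeff x b)       ≈⟨ *-congˡ (coeff-∙ l x b) ⟨
                k * coeff (l ∙ᶜ x) b      ≈⟨ coeff-∙ k (l ∙ᶜ x) b ⟨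
                coeff (k ∙ᶜ l ∙ᶜ x) b     ∎
            ; *ₗ-zeroʳ = λ k → by-coeff λ b → refl
            ; *ₗ-distribˡ = λ k x y → by-coeff λ b →
                reflexive (≡.cong (λ t → coeff t b) (List.map-++ _ x y))
            }
          }
        ; -ᴹ‿cong = λ {x} {y} p → by-coeff λ b → begin
            coeff (-ᶜ x) b   ≈⟨ coeff-neg x b ⟩
            - coeff x b      ≈⟨ -‿cong (coeff-≈ p b) ⟩
            - coeff y b      ≈⟨ coeff-neg y b ⟨
            coeff (-ᶜ y) b   ∎
        ; -ᴹ‿inverse =
              (λ x → by-coeff λ b → begin
                coeff ((-ᶜ x) ++ x) b           ≈⟨ coeff-++ (-ᶜ x) x b ⟩
                coeff (-ᶜ x) b +ᴷ coeff x b     ≈⟨ +-congʳ (coeff-neg x b) ⟩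
                - coeff x b +ᴷ coeff x b        ≈⟨ -‿inverseˡ _ ⟩
                0#                              ∎)
            , (λ x → by-coeff λ b → begin
                coeff (x ++ (-ᶜ x)) b           ≈⟨ coeff-++ x (-ᶜ x) b ⟩
                coeff x b +ᴷ coeff (-ᶜ x) b     ≈⟨ +-congˡ (coeff-neg x b) ⟩
                coeff x b +ᴷ - coeff x b        ≈⟨ -‿inverseʳ _ ⟩
                0#                              ∎)
        }
      })
    }

module _ (R : CommutativeRing c ℓ₁) where
  open CommutativeRing R renaming (Carrier to K; _+_ to _+ᴷ_)
  open FreeModule R using (Comb; freeModule; coeff; by-coeff; coeff-≈)

  mapComb : ∀ {A B : DecSetoid 0ℓ 0ℓ} →
            (DecSetoid.Carrier A → DecSetoid.Carrier B) → Comb A → Comb B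
  mapComb f = map (Product.map₂ f)

  -- The bilinear extension of the map which sends a pair of basis elements
  -- (a , b) to the sum, with multiplicity, of the list f a b.
  bilinear : ∀ {A B C : DecSetoid 0ℓ 0ℓ} →
             (DecSetoid.Carrier A → DecSetoid.Carrier B → List (DecSetoid.Carrier C)) →
             Comb A → Comb B → Comb C
  bilinear f x y =
    concatMap (λ (k , a) → concatMap (λ (l , b) → map (k * l ,_) (f a b)) y) x

  module _ {A B : DecSetoid 0ℓ 0ℓ} where
    private
      module A = DecSetoid A
      module B = DecSetoid B
      module FA = FreeModule R A
      module FB = FreeModule R B

    select-⇔ : ∀ {P Q : Set} (d : Dec P) (e : Dec Q) → (P → Q) → (Q → P) →
               ∀ k → FA.select d k ≈ FB.select e k
    select-⇔ (yes p) (yes q) f g k = refl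
    select-⇔ (yes p) (no ¬q) f g k = contradiction (f p) ¬q
    select-⇔ (no ¬p) (yes q) f g k = contradiction (g q) ¬p
    select-⇔ (no ¬p) (no ¬q) f g k = refl

    module _ (f : A.Carrier → B.Carrier) (f⁻¹ : B.Carrier → A.Carrier)
             (f-adj  : ∀ a b → f a B.≈ b → a A.≈ f⁻¹ b)
             (f-adj⁻¹ : ∀ a b → a A.≈ f⁻¹ b → f a B.≈ b)
             where
      coeff-map : ∀ x b → coeff B (mapComb {A} {B} f x) b ≈ coeff A x (f⁻¹ b)
      coeff-map []            b = refl
      coeff-map ((k , a) ∷ x) b =
        +-cong (sym (select-⇔ (a A.≟ f⁻¹ b) (f a B.≟ b) (f-adj⁻¹ a b) (f-adj a b) k))
               (coeff-map x b)

      map-ext : ∀ {X Y Z : Set c} {W : Set c} {g : Y → Z} {h : X → Y} {g′ : W → Z} {h′ : X → W} →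
                (∀ x → g (h x) ≡ g′ (h′ x)) → ∀ xs → map g (map h xs) ≡ map g′ (map h′ xs)
      map-ext eq xs =
        ≡.trans (≡.sym (List.map-∘ xs)) (≡.trans (List.map-cong eq xs) (List.map-∘ xs))

      mapComb-linear : IsLinear (freeModule A) (freeModule B) (mapComb {A} {B} f)
      mapComb-linear = record
        { isBimoduleHomomorphism = record
          { +ᴹ-isGroupHomomorphism = record
            { isMonoidHomomorphism = record
              { isMagmaHomomorphism = record
                { isRelHomomorphism = record
                  { cong = λ {x} {y} p → by-coeff λ b →
                      trans (coeff-map x b) (trans (coeff-≈ p (f⁻¹ b)) (sym (coeff-map y b))) }
                ; homo = λ x y → by-coeff λ b →
                    reflexive (≡.cong (λ t → coeff B t b) (List.map-++ _ x y))
                }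
              ; ε-homo = by-coeff λ b → refl
              }
            ; ⁻¹-homo = λ x → by-coeff λ b →
                reflexive (≡.cong (λ t → coeff B t b) (map-ext (λ _ → ≡.refl) x))
            }
          ; *ₗ-homo = λ k x → by-coeff λ b →
              reflexive (≡.cong (λ t → coeff B t b) (map-ext (λ _ → ≡.refl) x))
          ; *ᵣ-homo = λ k x → by-coeff λ b →
              reflexive (≡.cong (λ t → coeff B t b) (map-ext (λ _ → ≡.refl) x))
          }
        }

    mapComb-cong : (f g : A.Carrier → B.Carrier) → (∀ a → f a B.≈ g a) →
                   ∀ x → mapComb {A} {B} f x FB.≈ᶜ mapComb {A} {B} g x
    mapComb-cong f g f≈g x = by-coeff (go x)
      where
      go : ∀ x b → coeff B (mapComb {A} {B} f x) b ≈ coeff B (mapComb {A} {B} g x) b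
      go []            b = refl
      go ((k , a) ∷ x) b =
        +-cong (trans (sym (select-⇔ (f a B.≟ b) (f a B.≟ b) id id k))
                      (select-⇔ (f a B.≟ b) (g a B.≟ b)
                        (B.trans (B.sym (f≈g a))) (B.trans (f≈g a)) k))
               (go x b)

Edge : Set → Set
Edge A = A × A

infix 4 _≈ᴱ_

_≈ᴱ_ : ∀ {A : Set} → Edge A → Edge A → Set
(a , b) ≈ᴱ (a′ , b′) = (a ≡ a′ × b ≡ b′) ⊎ (a ≡ b′ × b ≡ a′)

edgeSetoid : Set → Setoid 0ℓ 0ℓ
edgeSetoid A = record
  { Carrier       = Edge A
  ; _≈_           = _≈ᴱ_
  ; isEquivalence = record { refl = inj₁ (≡.refl , ≡.refl) ; sym = sym ; trans = trans }
  }
  where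
  sym : ∀ {e f : Edge A} → e ≈ᴱ f → f ≈ᴱ e
  sym (inj₁ (≡.refl , ≡.refl)) = inj₁ (≡.refl , ≡.refl)
  sym (inj₂ (≡.refl , ≡.refl)) = inj₂ (≡.refl , ≡.refl)

  trans : ∀ {e f g : Edge A} → e ≈ᴱ f → f ≈ᴱ g → e ≈ᴱ g
  trans (inj₁ (≡.refl , ≡.refl)) q                        = q
  trans (inj₂ (≡.refl , ≡.refl)) (inj₁ (≡.refl , ≡.refl)) = inj₂ (≡.refl , ≡.refl)
  trans (inj₂ (≡.refl , ≡.refl)) (inj₂ (≡.refl , ≡.refl)) = inj₁ (≡.refl , ≡.refl)

-- The vertex set is required to be nonempty, so that no basis element is left
-- for V = ∅.  The witness is irrelevant.
record Multigraph (V : FinSet) : Set where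
  constructor mkMultigraph
  field
    edges     : List (Edge ⟨ V ⟩)
    .nonempty : ⟨ V ⟩

open Multigraph public using (edges)

relabelEdge : ∀ {A B : Set} → (A → B) → Edge A → Edge B
relabelEdge f = Product.map f f

relabel : ∀ {V W} → V ≅ W → Multigraph V → Multigraph W
relabel σ (mkMultigraph es v) = mkMultigraph (map (relabelEdge (to σ)) es) (to σ v)

module _ (V : FinSet) where
  open Permutation (edgeSetoid ⟨ V ⟩)
  private
    module E = Setoid (edgeSetoid ⟨ V ⟩)
    module P = PermutationProperties (edgeSetoid ⟨ V ⟩)

  _≟ᴱ_ : Decidable (_≈ᴱ_ {⟨ V ⟩})
  (a , b) ≟ᴱ (a′ , b′) =
    (≡-dec V a a′ ×-dec ≡-dec V b b′) ⊎-dec (≡-dec V a b′ ×-dec ≡-dec V b a′)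

  extract : ∀ {x} {ys} (p : Any (x ≈ᴱ_) ys) → ys ↭ x ∷ (ys ─ p)
  extract (here x≈y) = prep (E.sym x≈y) ↭-refl
  extract {x} {y ∷ ys} (there p) =
    ↭-trans (prep E.refl (extract p)) (swap E.refl E.refl ↭-refl)

  _↭?_ : Decidable _↭_
  []       ↭? []       = yes ↭-refl
  []       ↭? (y ∷ ys) = no (P.¬x∷xs↭[] ∘ ↭-sym)
  (x ∷ xs) ↭? ys with any? (x ≟ᴱ_) ys
  ... | no  x∉ys = no λ p → x∉ys (P.∈-resp-↭ p (here E.refl))
  ... | yes x∈ys = map′
    (λ p → ↭-trans (prep E.refl p) (↭-sym (extract x∈ys)))
    (λ p → P.drop-∷ (↭-trans p (extract x∈ys)))
    (xs ↭? (ys ─ x∈ys))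

  -- Equality of multigraphs: equality of finite multisets of unordered pairs.
  multigraphs : DecSetoid 0ℓ 0ℓ
  multigraphs = record
    { Carrier          = Multigraph V
    ; _≈_              = λ g h → edges g ↭ edges h
    ; isDecEquivalence = record
      { isEquivalence = record { refl = ↭-refl ; sym = ↭-sym ; trans = ↭-trans }
      ; _≟_           = λ g h → edges g ↭? edges h
      }
    }

-- All the vertices to which an end may be attached after * (the point of 𝟙)
-- has been replaced by V₂.
reattachEnd : ∀ V₁ V₂ → ⟨ V₁ ⊕ 𝟙 ⟩ → List ⟨ V₁ ⊕ V₂ ⟩
reattachEnd V₁ V₂ (inj₁ v) = [ inj₁ v ]
reattachEnd V₁ V₂ (inj₂ *) = map inj₂ (elements V₂)

reattachEdge : ∀ V₁ V₂ → Edge ⟨ V₁ ⊕ 𝟙 ⟩ → List (Edge ⟨ V₁ ⊕ V₂ ⟩)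
reattachEdge V₁ V₂ (a , b) =
  cartesianProductWith _,_ (reattachEnd V₁ V₂ a) (reattachEnd V₁ V₂ b)

-- If m ends are attached to *, this list has one entry for each of the |V₂|^m
-- maps from these ends to V₂.
reattach : ∀ V₁ V₂ → List (Edge ⟨ V₁ ⊕ 𝟙 ⟩) → List (List (Edge ⟨ V₁ ⊕ V₂ ⟩))
reattach V₁ V₂ []       = [ [] ]
reattach V₁ V₂ (e ∷ es) = cartesianProductWith _∷_ (reattachEdge V₁ V₂ e) (reattach V₁ V₂ es)

compose : ∀ V₁ V₂ → Multigraph (V₁ ⊕ 𝟙) → Multigraph V₂ → List (Multigraph (V₁ ⊕ V₂))
compose V₁ V₂ (mkMultigraph es₁ _) (mkMultigraph es₂ v₂) =
  map (λ es → mkMultigraph (es ++ map (relabelEdge inj₂) es₂) (inj₂ v₂))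
      (reattach V₁ V₂ es₁)

relabelEdge-cong : ∀ {A B : Set} (f : A → B) {e e′ : Edge A} →
                   e ≈ᴱ e′ → relabelEdge f e ≈ᴱ relabelEdge f e′
relabelEdge-cong f = Sum.map (Product.map (≡.cong f) (≡.cong f))
                             (Product.map (≡.cong f) (≡.cong f))

relabelEdge-cancel : ∀ {A B : Set} (f : A → B) (f⁻¹ : B → A) → (∀ b → f (f⁻¹ b) ≡ b) →
                     ∀ es → map (relabelEdge f) (map (relabelEdge f⁻¹) es) ≡ es
relabelEdge-cancel f f⁻¹ eq es = ≡.trans (≡.sym (List.map-∘ es))
  (≡.trans (List.map-cong (λ (a , b) → ≡.cong₂ _,_ (eq a) (eq b)) es) (List.map-id es))

module _ (V W : FinSet) (σ : V ≅ W) where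
  open Permutation (edgeSetoid ⟨ V ⟩) using () renaming (_↭_ to _↭ⱽ_)
  open Permutation (edgeSetoid ⟨ W ⟩) using () renaming (_↭_ to _↭ᵂ_)

  relabel⁻¹ : Multigraph W → Multigraph V
  relabel⁻¹ (mkMultigraph es w) = mkMultigraph (map (relabelEdge (from σ)) es) (from σ w)

  relabel-adj : ∀ g h → edges (relabel σ g) ↭ᵂ edges h → edges g ↭ⱽ edges (relabel⁻¹ h)
  relabel-adj g h p = ≡.subst (_↭ⱽ edges (relabel⁻¹ h))
    (relabelEdge-cancel (from σ) (to σ) (Inverse.strictlyInverseʳ (_≅_.bijection σ)) (edges g))
    (PermutationProperties.map⁺ (edgeSetoid ⟨ W ⟩) (edgeSetoid ⟨ V ⟩) (relabelEdge-cong (from σ)) p)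

  relabel-adj⁻¹ : ∀ g h → edges g ↭ⱽ edges (relabel⁻¹ h) → edges (relabel σ g) ↭ᵂ edges h
  relabel-adj⁻¹ g h p = ≡.subst (edges (relabel σ g) ↭ᵂ_)
    (relabelEdge-cancel (to σ) (from σ) (Inverse.strictlyInverseˡ (_≅_.bijection σ)) (edges h))
    (PermutationProperties.map⁺ (edgeSetoid ⟨ V ⟩) (edgeSetoid ⟨ W ⟩) (relabelEdge-cong (to σ)) p)

module _ (K : HeytingField c ℓ₁ ℓ₂) where
  private
    R = fieldRing K
    open CommutativeRing R using (1#)

  MG : Species K c ℓ₁
  MG = record
    { obj        = λ V → FreeModule.freeModule R (multigraphs V)
    ; act        = λ {V} {W} σ → mapComb R {multigraphs V} {multigraphs W} (relabel σ)
    ; act-linear = λ {V} {W} σ → mapComb-linear R {multigraphs V} {multigraphs W}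
        (relabel σ) (relabel⁻¹ V W σ) (relabel-adj V W σ) (relabel-adj⁻¹ V W σ)
    ; act-cong   = λ {V} {W} σ τ eq → mapComb-cong R {multigraphs V} {multigraphs W}
        (relabel σ) (relabel τ) λ g → Permutation.↭-reflexive (edgeSetoid ⟨ W ⟩)
          (List.map-cong (λ (a , b) → ≡.cong₂ _,_ (eq a) (eq b)) (edges g))
    ; act-id     = λ {V} x → ≡.subst
        (λ y → FreeModule._≈ᶜ_ R (multigraphs V) (mapComb R {multigraphs V} {multigraphs V} (relabel ≅-id) x) y)
        (List.map-id x)
        (mapComb-cong R {multigraphs V} {multigraphs V} (relabel ≅-id) id
          (λ g → Permutation.↭-reflexive (edgeSetoid ⟨ V ⟩) (List.map-id (edges g))) x)
    ; act-∘      = λ {U} {V} {W} τ σ x → ≡.subst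
        (λ y → FreeModule._≈ᶜ_ R (multigraphs W) (mapComb R {multigraphs U} {multigraphs W} (relabel (τ ≅-∘ σ)) x) y)
        (List.map-∘ x)
        (mapComb-cong R {multigraphs U} {multigraphs W} (relabel (τ ≅-∘ σ)) (relabel τ ∘ relabel σ)
          (λ g → Permutation.↭-reflexive (edgeSetoid ⟨ W ⟩) (List.map-∘ (edges g))) x)
    }

  open Species MG using (Elem)

  MG-unit : ∀ V v → IsOnlyElement V v → Elem V
  MG-unit V v _ = [ (1# , mkMultigraph [] v) ]

  MG-comp : ∀ V₁ V₂ → Elem (V₁ ⊕ 𝟙) → Elem V₂ → Elem (V₁ ⊕ V₂)
  MG-comp V₁ V₂ =
    bilinear R {multigraphs (V₁ ⊕ 𝟙)} {multigraphs V₂} {multigraphs (V₁ ⊕ V₂)} (compose V₁ V₂)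

{-# OPTIONS --safe #-}
module Submission where

open import Algebra.Apartness.Bundles using (HeytingField)
open import Algebra.Bundles using (CommutativeRing)
import Algebra.Properties.AbelianGroup as AbelianGroupProperties
import Algebra.Properties.CommutativeSemigroup as CommutativeSemigroupProperties
open import Algebra.Module.Bundles using (Module)
open import Data.List.Base using (List; []; _∷_; [_]; _++_; map; concatMap; cartesianProductWith; filter; length)
import Data.List.Properties as List
open import Data.List.Membership.Propositional using (_∈_)
open import Data.List.Membership.Propositional.Properties using (∈-map⁺; ∈-map⁻; ∈-++⁺ˡ; ∈-++⁺ʳ; ∈-allFin)
open import Data.List.Membership.Propositional.Properties.WithK using (unique∧set⇒bag)
open import Data.List.Relation.Binary.BagAndSetEquality using (∼bag⇒↭)
open import Data.List.Relation.Binary.Permutation.Propositional as Perm using (_↭_)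
open import Data.List.Relation.Binary.Pointwise.Base using ([]; _∷_)
import Data.List.Relation.Binary.Permutation.Homogeneous as Homogeneous
import Data.List.Relation.Binary.Permutation.Setoid as Permutation
import Data.List.Relation.Binary.Permutation.Setoid.Properties as PermutationProperties
open import Data.List.Relation.Unary.All using ([]; _∷_)
open import Data.List.Relation.Unary.AllPairs using ([]; _∷_)
open import Data.List.Relation.Unary.Any using (here)
open import Data.List.Relation.Unary.Unique.Propositional using (Unique)
import Data.List.Relation.Unary.Unique.Propositional.Properties as Unique
open import Data.Nat.Base as ℕ using (s≤s)
import Data.Nat.Properties as ℕ
open import Data.Product.Base as Product using (_×_; _,_)
open import Data.Sum.Base using (inj₁; inj₂)
open import Data.Sum.Properties using (inj₁-injective; inj₂-injective)
open import Data.Unit.Base using (tt)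
open import Function.Base using (_∘_)
open import Function.Bundles using (Inverse; mk⇔)
open import Function.Definitions using (Congruent)
open import Level using (Level; 0ℓ)
open import Relation.Binary.Bundles using (DecSetoid)
open import Relation.Binary.PropositionalEquality as ≡ using (_≡_)
open import Relation.Nullary using (¬_; Dec; yes; no; ¬?; contradiction)
open import Relation.Nullary.Negation using (contradiction-irr)

open import Defs

-- A linear combination x of multigraphs is determined by the values ∫ x φ at x
-- of the linear extensions of all functions φ on multigraphs, so each axiom
-- reduces to an identity of finite sums of an arbitrary φ.  Composing graphs
-- replaces each edge end independently by a list of choices, and doing so twice
-- is again of this form, the lists being combined by concatMap.  Hence it
-- suffices to compare the choices for a single end: associativity comes down to
-- V₂ ⊔ {*} with * replaced by V₃ being V₂ ⊔ V₃.

-- Graphs are identified up to reordering edges and flipping their ends, so only functions `φ`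
-- respecting this identification descend to the module. Indicators of classes are among them, hence
-- testing against such `φ` recovers all coefficients. The converse, that equal combinations pair
-- equally with every such `φ`, is what makes composition well defined on the module; it requires
-- regrouping terms by class, because equal combinations may be very different lists. The reduction
-- to single ends rests on independence: the list of choices for one end never depends on the choice
-- made for another, so the nested finite sums can be interchanged. Lists of choices are compared
-- only through their sums, because their order depends on the chosen enumerations of the vertex
-- sets.

private
  variable
    c ℓ ℓ₂ : Level
    X Y Z : Set

-- Enumerations of finite sets, up to permutation

Complete : List X → Set
Complete {X} xs = ∀ x → x ∈ xs

-- Membership in a duplicate-free list has at most one proof, so having the same members already
-- means being equal as bags. This makes sums over a vertex set independent of its enumeration,
-- without computing through `enum`.
unique-complete-↭ : {xs ys : List X} → Unique xs → Complete xs →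
                    Unique ys → Complete ys → xs ↭ ys
unique-complete-↭ xs! xs∋ ys! ys∋ =
  ∼bag⇒↭ (unique∧set⇒bag xs! ys! (mk⇔ (λ _ → ys∋ _) (λ _ → xs∋ _)))

elements-unique : ∀ V → Unique (elements V)
elements-unique V = Unique.map⁺ from-injective (Unique.allFin⁺ _)
  where
  open Inverse (FinSet.enum V) using (strictlyInverseˡ) renaming (to to index; from to element)
  from-injective : ∀ {i j} → element i ≡ element j → i ≡ j
  from-injective {i} {j} eq =
    ≡.trans (≡.sym (strictlyInverseˡ i)) (≡.trans (≡.cong index eq) (strictlyInverseˡ j))

elements-complete : ∀ V → Complete (elements V)
elements-complete V v =
  ≡.subst (_∈ elements V) (strictlyInverseʳ v) (∈-map⁺ element (∈-allFin (index v)))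
  where open Inverse (FinSet.enum V) using (strictlyInverseʳ) renaming (to to index; from to element)

elements-⊕ : ∀ V W → elements (V ⊕ W) ↭ map inj₁ (elements V) ++ map inj₂ (elements W)
elements-⊕ V W = unique-complete-↭
  (elements-unique (V ⊕ W)) (elements-complete (V ⊕ W))
  (Unique.++⁺ (Unique.map⁺ inj₁-injective (elements-unique V))
              (Unique.map⁺ inj₂-injective (elements-unique W))
              disjoint)
  λ where
    (inj₁ v) → ∈-++⁺ˡ (∈-map⁺ inj₁ (elements-complete V v))
    (inj₂ w) → ∈-++⁺ʳ (map inj₁ (elements V)) (∈-map⁺ inj₂ (elements-complete W w))
  where
  disjoint : ∀ {x} → ¬ (x ∈ map inj₁ (elements V) × x ∈ map inj₂ (elements W))
  disjoint (p , q) with ∈-map⁻ inj₁ p | ∈-map⁻ inj₂ q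
  ... | _ , _ , ≡.refl | _ , _ , ()

elements-≅ : ∀ {V W} (σ : V ≅ W) → elements W ↭ map (to σ) (elements V)
elements-≅ {V} {W} σ = unique-complete-↭ (elements-unique W) (elements-complete W)
  (Unique.map⁺ to-injective (elements-unique V))
  λ w → ≡.subst (_∈ map (to σ) (elements V)) (strictlyInverseˡ w)
          (∈-map⁺ (to σ) (elements-complete V (from σ w)))
  where
  open Inverse (_≅_.bijection σ) using (strictlyInverseˡ; strictlyInverseʳ)
  to-injective : ∀ {u v} → to σ u ≡ to σ v → u ≡ v
  to-injective {u} {v} eq =
    ≡.trans (≡.sym (strictlyInverseʳ u)) (≡.trans (≡.cong (from σ) eq) (strictlyInverseʳ v))

elements-point : ∀ V v → IsOnlyElement V v → elements V ↭ [ v ]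
elements-point V v only = unique-complete-↭ (elements-unique V) (elements-complete V)
  ([] ∷ []) (λ w → here (only w))

-- Independent choices for edge ends

infix 4 _↭ᴱ_
_↭ᴱ_ : List (Edge X) → List (Edge X) → Set
_↭ᴱ_ {X} = Permutation._↭_ (edgeSetoid X)

↭ᴱ-refl : {es : List (Edge X)} → es ↭ᴱ es
↭ᴱ-refl {X} = Permutation.↭-refl (edgeSetoid X)

↭ᴱ-reflexive : {es fs : List (Edge X)} → es ≡ fs → es ↭ᴱ fs
↭ᴱ-reflexive {X} = Permutation.↭-reflexive (edgeSetoid X)

≈ᴱ-refl : {e : Edge X} → e ≈ᴱ e
≈ᴱ-refl = inj₁ (≡.refl , ≡.refl)

attachEdge : (X → List Y) → Edge X → List (Edge Y)
attachEdge t (a , b) = cartesianProductWith _,_ (t a) (t b)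

-- Like reattach, but with an arbitrary list t a of choices for each end at a:
-- iterated reattachments and relabellings are again of this form.
attach : (X → List Y) → List (Edge X) → List (List (Edge Y))
attach t []       = [ [] ]
attach t (e ∷ es) = cartesianProductWith _∷_ (attachEdge t e) (attach t es)

reattach-attach : ∀ V₁ V₂ es → reattach V₁ V₂ es ≡ attach (reattachEnd V₁ V₂) es
reattach-attach V₁ V₂ []       = ≡.refl
reattach-attach V₁ V₂ (e ∷ es) =
  ≡.cong (cartesianProductWith _∷_ (reattachEdge V₁ V₂ e)) (reattach-attach V₁ V₂ es)

attach-relabel : ∀ (t : Y → List Z) (f : X → Y) es →
                 attach t (map (relabelEdge f) es) ≡ attach (t ∘ f) es
attach-relabel t f []       = ≡.refl
attach-relabel t f (e ∷ es) =
  ≡.cong (cartesianProductWith _∷_ (attachEdge (t ∘ f) e)) (attach-relabel t f es)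

-- Separates the second graph, whose edges are merely added, from the choices, which concern the
-- edges of the first graph alone.
glue : ∀ {V₁ V₂} → Multigraph V₂ → List (Edge ⟨ V₁ ⊕ V₂ ⟩) → Multigraph (V₁ ⊕ V₂)
glue (mkMultigraph es₂ v₂) es = mkMultigraph (es ++ map (relabelEdge inj₂) es₂) (inj₂ v₂)

compose-attach : ∀ V₁ V₂ g h →
                 compose V₁ V₂ g h ≡ map (glue h) (attach (reattachEnd V₁ V₂) (edges g))
compose-attach V₁ V₂ g h = ≡.cong (map (glue h)) (reattach-attach V₁ V₂ (edges g))

-- Finite sums and linear extensions

module Sums (R : CommutativeRing c ℓ) where
  open CommutativeRing R renaming (Carrier to K)
  open import Relation.Binary.Reasoning.Setoid setoid
  open CommutativeSemigroupProperties +-commutativeSemigroup using (interchange; x∙yz≈y∙xz)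
  open CommutativeSemigroupProperties *-commutativeSemigroup
    using () renaming (x∙yz≈y∙xz to x*yz≈y*xz)

  ∑ : ∀ {a} {A : Set a} → List A → (A → K) → K
  ∑ []       φ = 0#
  ∑ (x ∷ xs) φ = φ x + ∑ xs φ

  module _ {a} {A : Set a} where
    ∑-cong : ∀ (xs : List A) {φ ψ : A → K} → (∀ x → φ x ≈ ψ x) → ∑ xs φ ≈ ∑ xs ψ
    ∑-cong []       eq = refl
    ∑-cong (x ∷ xs) eq = +-cong (eq x) (∑-cong xs eq)

    ∑-++ : ∀ (xs ys : List A) φ → ∑ (xs ++ ys) φ ≈ ∑ xs φ + ∑ ys φ
    ∑-++ []       ys φ = sym (+-identityˡ _)
    ∑-++ (x ∷ xs) ys φ = trans (+-congˡ (∑-++ xs ys φ)) (sym (+-assoc _ _ _))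

    ∑-↭ : ∀ {xs ys : List A} → xs ↭ ys → ∀ φ → ∑ xs φ ≈ ∑ ys φ
    ∑-↭ Perm.refl         φ = refl
    ∑-↭ (Perm.prep x p)   φ = +-congˡ (∑-↭ p φ)
    ∑-↭ (Perm.swap x y p) φ = trans (x∙yz≈y∙xz _ _ _) (+-congˡ (+-congˡ (∑-↭ p φ)))
    ∑-↭ (Perm.trans p q)  φ = trans (∑-↭ p φ) (∑-↭ q φ)

    ∑-zero : ∀ (xs : List A) → ∑ xs (λ _ → 0#) ≈ 0#
    ∑-zero []       = refl
    ∑-zero (x ∷ xs) = trans (+-identityˡ _) (∑-zero xs)

    ∑-+ : ∀ (xs : List A) φ ψ → ∑ xs (λ x → φ x + ψ x) ≈ ∑ xs φ + ∑ xs ψ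
    ∑-+ []       φ ψ = sym (+-identityˡ _)
    ∑-+ (x ∷ xs) φ ψ = trans (+-congˡ (∑-+ xs φ ψ)) (interchange _ _ _ _)

    *-∑ : ∀ k (xs : List A) φ → k * ∑ xs φ ≈ ∑ xs (λ x → k * φ x)
    *-∑ k []       φ = zeroʳ k
    *-∑ k (x ∷ xs) φ = trans (distribˡ _ _ _) (+-congˡ (*-∑ k xs φ))

  module _ {a b} {A : Set a} {B : Set b} where
    ∑-map : ∀ (f : A → B) xs φ → ∑ (map f xs) φ ≈ ∑ xs (φ ∘ f)
    ∑-map f []       φ = refl
    ∑-map f (x ∷ xs) φ = +-congˡ (∑-map f xs φ)

    ∑-concatMap : ∀ (f : A → List B) xs φ → ∑ (concatMap f xs) φ ≈ ∑ xs (λ x → ∑ (f x) φ)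
    ∑-concatMap f []       φ = refl
    ∑-concatMap f (x ∷ xs) φ = trans (∑-++ (f x) _ φ) (+-congˡ (∑-concatMap f xs φ))

    ∑-swap : ∀ (xs : List A) (ys : List B) (φ : A → B → K) →
             ∑ xs (λ x → ∑ ys (φ x)) ≈ ∑ ys (λ y → ∑ xs (λ x → φ x y))
    ∑-swap []       ys φ = sym (∑-zero ys)
    ∑-swap (x ∷ xs) ys φ = trans (+-congˡ (∑-swap xs ys φ)) (sym (∑-+ ys _ _))

  ∑-cartesianProductWith : ∀ {a b d} {A : Set a} {B : Set b} {D : Set d} (f : A → B → D) xs ys φ →
    ∑ (cartesianProductWith f xs ys) φ ≈ ∑ xs (λ x → ∑ ys (λ y → φ (f x y)))
  ∑-cartesianProductWith f []       ys φ = refl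
  ∑-cartesianProductWith f (x ∷ xs) ys φ =
    trans (∑-++ (map (f x) ys) _ φ)
          (+-cong (∑-map (f x) ys φ) (∑-cartesianProductWith f xs ys φ))

  -- The value at x of the linear extension of φ.
  ∫ : List (K × X) → (X → K) → K
  ∫ x φ = ∑ x (λ (k , a) → k * φ a)

  ∫-cong : ∀ (x : List (K × X)) {φ ψ} → (∀ a → φ a ≈ ψ a) → ∫ x φ ≈ ∫ x ψ
  ∫-cong x eq = ∑-cong x (λ (k , a) → *-congˡ (eq a))

  ∫-∑ : ∀ {b} {B : Set b} (x : List (K × X)) (ys : List B) (φ : X → B → K) →
        ∫ x (λ a → ∑ ys (φ a)) ≈ ∑ ys (λ y → ∫ x (λ a → φ a y))
  ∫-∑ x ys φ = trans (∑-cong x (λ (k , a) → *-∑ k ys (φ a))) (∑-swap x ys _)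

  *-∫ : ∀ k (x : List (K × X)) φ → k * ∫ x φ ≈ ∫ x (λ a → k * φ a)
  *-∫ k x φ = trans (*-∑ k x _) (∑-cong x (λ _ → x*yz≈y*xz _ _ _))

  ∫-swap : ∀ (x : List (K × X)) (y : List (K × Y)) (φ : X → Y → K) →
           ∫ x (λ a → ∫ y (φ a)) ≈ ∫ y (λ b → ∫ x (λ a → φ a b))
  ∫-swap x y φ = trans (∫-∑ x y _) (∑-cong y (λ (l , b) → sym (*-∫ l x _)))

  ∫-map₂ : ∀ (f : X → Y) (x : List (K × X)) φ → ∫ (map (Product.map₂ f) x) φ ≈ ∫ x (φ ∘ f)
  ∫-map₂ f x φ = ∑-map _ x _

  -- Pairing combinations with invariant functions

  module Pairing (B : DecSetoid 0ℓ 0ℓ) where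
    open DecSetoid B using (_≟_) renaming (Carrier to Basis; _≈_ to _≈ᴮ_)
    private module B = DecSetoid B
    open FreeModule R B
    open AbelianGroupProperties +-abelianGroup using (⁻¹-∙-comm; ε⁻¹≈ε; inverseˡ-unique; x∙y⁻¹≈ε⇒x≈y)

    Invariant : (Basis → K) → Set _
    Invariant = Congruent _≈ᴮ_ _≈_

    ∫-∙ : ∀ k x φ → ∫ (k ∙ᶜ x) φ ≈ k * ∫ x φ
    ∫-∙ k x φ = begin
      ∫ (k ∙ᶜ x) φ                        ≈⟨ ∑-map _ x _ ⟩
      ∑ x (λ (l , a) → (k * l) * φ a)     ≈⟨ ∑-cong x (λ _ → *-assoc _ _ _) ⟩
      ∑ x (λ (l , a) → k * (l * φ a))     ≈⟨ *-∑ k x _ ⟨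
      k * ∫ x φ                           ∎

    private
      select-* : ∀ {P : Set} (d : Dec P) k → k * select d 1# ≈ select d k
      select-* (yes _) k = *-identityʳ k
      select-* (no _)  k = zeroʳ k

    ∫-neg : ∀ x φ → ∫ (-ᶜ x) φ ≈ - ∫ x φ
    ∫-neg []            φ = sym ε⁻¹≈ε
    ∫-neg ((k , a) ∷ x) φ = trans (+-cong (neg-* _ _) (∫-neg x φ)) (⁻¹-∙-comm _ _)
      where
      neg-* : ∀ k l → (- k) * l ≈ - (k * l)
      neg-* k l = inverseˡ-unique _ _ (begin
        (- k) * l + k * l   ≈⟨ distribʳ l (- k) k ⟨
        (- k + k) * l       ≈⟨ *-congʳ (-‿inverseˡ k) ⟩
        0# * l              ≈⟨ zeroˡ l ⟩
        0#                  ∎)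

    coeff-as-∫ : ∀ x b → ∫ x (λ a → select (a ≟ b) 1#) ≈ coeff x b
    coeff-as-∫ []            b = refl
    coeff-as-∫ ((k , a) ∷ x) b = +-cong (select-* (a ≟ b) k) (coeff-as-∫ x b)

    indicator-invariant : ∀ b → Invariant (λ a → select (a ≟ b) 1#)
    indicator-invariant b {a} {a′} eq =
      select-⇔ R {B} {B} (a ≟ b) (a′ ≟ b) (B.trans (B.sym eq)) (B.trans eq) 1#

    ∫⇒≈ᶜ : ∀ {x y} → (∀ φ → Invariant φ → ∫ x φ ≈ ∫ y φ) → x ≈ᶜ y
    ∫⇒≈ᶜ {x} {y} eq = by-coeff λ b → begin
      coeff x b   ≈⟨ coeff-as-∫ x b ⟨
      ∫ x _       ≈⟨ eq _ (indicator-invariant b) ⟩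
      ∫ y _       ≈⟨ coeff-as-∫ y b ⟩
      coeff y b   ∎

    -- Drops the whole class of `a`, not just one term: regrouping a combination means splitting off
    -- one class at a time.
    erase : Basis → Comb → Comb
    erase a = filter (λ (_ , b) → ¬? (b ≟ a))

    -- On the class of `a` an invariant `φ` is constant, so the terms of that class contribute their
    -- total coefficient times `φ a`.
    ∫-erase : ∀ a x {φ} → Invariant φ → ∫ x φ ≈ coeff x a * φ a + ∫ (erase a x) φ
    ∫-erase a []            φ-inv = sym (trans (+-identityʳ _) (zeroˡ _))
    ∫-erase a ((k , b) ∷ x) {φ} φ-inv with b ≟ a
    ... | yes b≈a = begin
      k * φ b + ∫ x φ                                   ≈⟨ +-cong (*-congˡ (φ-inv b≈a)) (∫-erase a x φ-inv) ⟩
      k * φ a + (coeff x a * φ a + ∫ (erase a x) φ)     ≈⟨ +-assoc _ _ _ ⟨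
      (k * φ a + coeff x a * φ a) + ∫ (erase a x) φ     ≈⟨ +-congʳ (distribʳ _ _ _) ⟨
      (k + coeff x a) * φ a + ∫ (erase a x) φ           ∎
    ... | no _ = begin
      k * φ b + ∫ x φ                                   ≈⟨ +-congˡ (∫-erase a x φ-inv) ⟩
      k * φ b + (coeff x a * φ a + ∫ (erase a x) φ)     ≈⟨ x∙yz≈y∙xz _ _ _ ⟩
      coeff x a * φ a + (k * φ b + ∫ (erase a x) φ)     ≈⟨ +-congʳ (*-congʳ (+-identityˡ _)) ⟨
      (0# + coeff x a) * φ a + (k * φ b + ∫ (erase a x) φ) ∎

    -- Apply `∫-erase` to the indicator of `b`: the split-off term carries the coefficient of `a`,
    -- which is zero.
    erase-vanishing : ∀ a x → x ≈ᶜ [] → erase a x ≈ᶜ []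
    erase-vanishing a x x≈0 = by-coeff λ b → begin
      coeff (erase a x) b                                  ≈⟨ coeff-as-∫ (erase a x) b ⟨
      ∫ (erase a x) (δ b)                                  ≈⟨ +-identityˡ _ ⟨
      0# + ∫ (erase a x) (δ b)                             ≈⟨ +-congʳ (zeroˡ _) ⟨
      0# * δ b a + ∫ (erase a x) (δ b)                     ≈⟨ +-congʳ (*-congʳ (coeff-≈ x≈0 a)) ⟨
      coeff x a * δ b a + ∫ (erase a x) (δ b)              ≈⟨ ∫-erase a x (indicator-invariant b) ⟨
      ∫ x (δ b)                                            ≈⟨ coeff-as-∫ x b ⟩
      coeff x b                                            ≈⟨ coeff-≈ x≈0 b ⟩
      0#                                                   ∎
      where
      δ : Basis → Basis → K
      δ b a = select (a ≟ b) 1#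

    -- Split off the class of the first term: it contributes zero, and what remains again has
    -- vanishing coefficients.
    ∫-vanishing : ∀ x {φ} → Invariant φ → x ≈ᶜ [] → ∫ x φ ≈ 0#
    ∫-vanishing x {φ} φ-inv = go (length x) x ℕ.≤-refl
      where
      -- `erase a x` is not a structural part of `x`, so the recursion runs on a bound `n` for the
      -- length.
      go : ∀ n x → length x ℕ.≤ n → x ≈ᶜ [] → ∫ x φ ≈ 0#
      go n         []                  _       x≈0 = refl
      go (ℕ.suc n) x@((k , a) ∷ x′) (s≤s len) x≈0 = begin
        ∫ x φ                                ≈⟨ ∫-erase a x φ-inv ⟩
        coeff x a * φ a + ∫ (erase a x) φ    ≈⟨ +-cong (*-congʳ (coeff-≈ x≈0 a))
                                                       (go n (erase a x) shorter (erase-vanishing a x x≈0)) ⟩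
        0# * φ a + 0#                        ≈⟨ +-identityʳ _ ⟩
        0# * φ a                             ≈⟨ zeroˡ _ ⟩
        0#                                   ∎
        where
        shorter : length (erase a x) ℕ.≤ n
        -- The head lies in its own class and is therefore dropped, which makes the bound decrease
        -- strictly.
        shorter with a ≟ a
        ... | yes _  = ℕ.≤-trans (List.length-filter _ x′) len
        ... | no a≉a = contradiction B.refl a≉a

    -- By additivity it is enough that the difference, all of whose coefficients vanish, pairs to
    -- zero.
    ≈ᶜ⇒∫ : ∀ {x y φ} → Invariant φ → x ≈ᶜ y → ∫ x φ ≈ ∫ y φ
    ≈ᶜ⇒∫ {x} {y} {φ} φ-inv x≈y = x∙y⁻¹≈ε⇒x≈y _ _ (begin
      ∫ x φ + - ∫ y φ          ≈⟨ +-congˡ (∫-neg y φ) ⟨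
      ∫ x φ + ∫ (-ᶜ y) φ       ≈⟨ ∑-++ x (-ᶜ y) _ ⟨
      ∫ (x ++ (-ᶜ y)) φ        ≈⟨ ∫-vanishing (x ++ (-ᶜ y)) φ-inv difference ⟩
      0#                       ∎)
      where
      open Module freeModule using (+ᴹ-congʳ; -ᴹ‿inverseʳ; ≈ᴹ-trans)
      difference : x ++ (-ᶜ y) ≈ᶜ []
      difference = ≈ᴹ-trans (+ᴹ-congʳ {x = -ᶜ y} x≈y) (-ᴹ‿inverseʳ y)

  -- Linearity by transposition

  module _ (A B : DecSetoid 0ℓ 0ℓ) where
    private
      module A = Pairing A
      module B = Pairing B
    open FreeModule R using (Comb; freeModule)

    -- `F*` is the transpose of `F`. Since pairings determine combinations and are linear in them,
    -- additivity and homogeneity are inherited through `adj`; that `F*` preserves invariance makes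
    -- `F` respect equality of combinations.
    adjoint⇒linear : (F : Comb A → Comb B)
                     (F* : (DecSetoid.Carrier B → K) → DecSetoid.Carrier A → K) →
                     (∀ {φ} → B.Invariant φ → A.Invariant (F* φ)) →
                     (∀ x φ → ∫ (F x) φ ≈ ∫ x (F* φ)) →
                     IsLinear (freeModule A) (freeModule B) F
    adjoint⇒linear F F* F*-inv adj = record
      { isBimoduleHomomorphism = record
        { +ᴹ-isGroupHomomorphism = record
          { isMonoidHomomorphism = record
            { isMagmaHomomorphism = record
              { isRelHomomorphism = record
                { cong = λ {x} {y} x≈y → B.∫⇒≈ᶜ λ φ φ-inv → begin
                    ∫ (F x) φ    ≈⟨ adj x φ ⟩
                    ∫ x (F* φ)   ≈⟨ A.≈ᶜ⇒∫ (F*-inv φ-inv) x≈y ⟩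
                    ∫ y (F* φ)   ≈⟨ adj y φ ⟨
                    ∫ (F y) φ    ∎ }
              ; homo = λ x y → B.∫⇒≈ᶜ λ φ _ → begin
                  ∫ (F (x ++ y)) φ          ≈⟨ adj (x ++ y) φ ⟩
                  ∫ (x ++ y) (F* φ)         ≈⟨ ∑-++ x y _ ⟩
                  ∫ x (F* φ) + ∫ y (F* φ)   ≈⟨ +-cong (adj x φ) (adj y φ) ⟨
                  ∫ (F x) φ + ∫ (F y) φ     ≈⟨ ∑-++ (F x) (F y) _ ⟨
                  ∫ (F x ++ F y) φ          ∎
              }
            ; ε-homo = B.∫⇒≈ᶜ λ φ _ → adj [] φ
            }
          ; ⁻¹-homo = λ x → B.∫⇒≈ᶜ λ φ _ → begin
              ∫ (F (FA.-ᶜ x)) φ    ≈⟨ adj (FA.-ᶜ x) φ ⟩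
              ∫ (FA.-ᶜ x) (F* φ)   ≈⟨ A.∫-neg x _ ⟩
              - ∫ x (F* φ)         ≈⟨ -‿cong (adj x φ) ⟨
              - ∫ (F x) φ          ≈⟨ B.∫-neg (F x) φ ⟨
              ∫ (FB.-ᶜ F x) φ      ∎
          }
        ; *ₗ-homo = scalar
        ; *ᵣ-homo = scalar
        }
      }
      where
      module FA = FreeModule R A
      module FB = FreeModule R B
      scalar : ∀ k x → F (k FA.∙ᶜ x) FB.≈ᶜ k FB.∙ᶜ F x
      scalar k x = B.∫⇒≈ᶜ λ φ _ → begin
        ∫ (F (k FA.∙ᶜ x)) φ    ≈⟨ adj (k FA.∙ᶜ x) φ ⟩
        ∫ (k FA.∙ᶜ x) (F* φ)   ≈⟨ A.∫-∙ k x _ ⟩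
        k * ∫ x (F* φ)         ≈⟨ *-congˡ (adj x φ) ⟨
        k * ∫ (F x) φ          ≈⟨ B.∫-∙ k (F x) φ ⟨
        ∫ (k FB.∙ᶜ F x) φ      ∎

  -- Turns a bilinear extension into an iterated integral, whose order can then be exchanged by
  -- `∫-swap`.
  ∫-bilinear : ∀ {A B C : DecSetoid 0ℓ 0ℓ}
    (f : DecSetoid.Carrier A → DecSetoid.Carrier B → List (DecSetoid.Carrier C)) x y φ →
    ∫ (bilinear R {A} {B} {C} f x y) φ ≈ ∫ x (λ a → ∫ y (λ b → ∑ (f a b) φ))
  ∫-bilinear f x y φ = begin
    ∫ (concatMap _ x) φ
      ≈⟨ ∑-concatMap _ x _ ⟩
    ∑ x (λ (k , a) → ∑ (concatMap _ y) _)
      ≈⟨ ∑-cong x (λ (k , a) → ∑-concatMap _ y _) ⟩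
    ∑ x (λ (k , a) → ∑ y (λ (l , b) → ∑ (map (k * l ,_) (f a b)) _))
      ≈⟨ ∑-cong x (λ (k , a) → ∑-cong y (λ (l , b) → inner k l (f a b))) ⟩
    ∑ x (λ (k , a) → ∑ y (λ (l , b) → k * (l * ∑ (f a b) φ)))
      ≈⟨ ∑-cong x (λ (k , a) → *-∑ k y _) ⟨
    ∫ x (λ a → ∫ y (λ b → ∑ (f a b) φ)) ∎
    where
    inner : ∀ k l cs → ∫ (map (k * l ,_) cs) φ ≈ k * (l * ∑ cs φ)
    inner k l cs = begin
      ∫ (map (k * l ,_) cs) φ       ≈⟨ ∑-map _ cs _ ⟩
      ∑ cs (λ c → (k * l) * φ c)    ≈⟨ *-∑ (k * l) cs φ ⟨
      (k * l) * ∑ cs φ              ≈⟨ *-assoc k l _ ⟩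
      k * (l * ∑ cs φ)              ∎

  -- Sums over independent choices of ends

  infix 4 _≐_
  _≐_ : (X → List Y) → (X → List Y) → Set _
  t ≐ s = ∀ a φ → ∑ (t a) φ ≈ ∑ (s a) φ

  ∑-attachEdge : ∀ (t : X → List Y) a b χ →
    ∑ (attachEdge t (a , b)) χ ≈ ∑ (t a) (λ a′ → ∑ (t b) (λ b′ → χ (a′ , b′)))
  ∑-attachEdge t a b χ = ∑-cartesianProductWith _,_ (t a) (t b) χ

  ∑-attach-∷ : ∀ (t : X → List Y) e es ψ →
    ∑ (attach t (e ∷ es)) ψ ≈ ∑ (attachEdge t e) (λ e′ → ∑ (attach t es) (λ es′ → ψ (e′ ∷ es′)))
  ∑-attach-∷ t e es ψ = ∑-cartesianProductWith _∷_ (attachEdge t e) (attach t es) ψ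

  ∑-attachEdge-≐ : ∀ {t s : X → List Y} → t ≐ s → ∀ e χ →
                   ∑ (attachEdge t e) χ ≈ ∑ (attachEdge s e) χ
  ∑-attachEdge-≐ {t = t} {s} t≐s (a , b) χ = begin
    ∑ (attachEdge t (a , b)) χ                           ≈⟨ ∑-attachEdge t a b χ ⟩
    ∑ (t a) (λ a′ → ∑ (t b) (λ b′ → χ (a′ , b′)))        ≈⟨ ∑-cong (t a) (λ a′ → t≐s b _) ⟩
    ∑ (t a) (λ a′ → ∑ (s b) (λ b′ → χ (a′ , b′)))        ≈⟨ t≐s a _ ⟩
    ∑ (s a) (λ a′ → ∑ (s b) (λ b′ → χ (a′ , b′)))        ≈⟨ ∑-attachEdge s a b χ ⟨
    ∑ (attachEdge s (a , b)) χ                           ∎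

  ∑-attach-≐ : ∀ {t s : X → List Y} → t ≐ s → ∀ es ψ → ∑ (attach t es) ψ ≈ ∑ (attach s es) ψ
  ∑-attach-≐ t≐s []       ψ = refl
  ∑-attach-≐ {t = t} {s} t≐s (e ∷ es) ψ = begin
    ∑ (attach t (e ∷ es)) ψ                                  ≈⟨ ∑-attach-∷ t e es ψ ⟩
    ∑ (attachEdge t e) (λ e′ → ∑ (attach t es) _)
      ≈⟨ ∑-cong (attachEdge t e) (λ e′ → ∑-attach-≐ {t = t} {s} t≐s es _) ⟩
    ∑ (attachEdge t e) (λ e′ → ∑ (attach s es) _)            ≈⟨ ∑-attachEdge-≐ {t = t} {s} t≐s e _ ⟩
    ∑ (attachEdge s e) (λ e′ → ∑ (attach s es) _)            ≈⟨ ∑-attach-∷ s e es ψ ⟨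
    ∑ (attach s (e ∷ es)) ψ                                  ∎

  ∑-attach-++ : ∀ (t : X → List Y) es fs ψ →
    ∑ (attach t (es ++ fs)) ψ ≈ ∑ (attach t es) (λ es′ → ∑ (attach t fs) (λ fs′ → ψ (es′ ++ fs′)))
  ∑-attach-++ t []       fs ψ = sym (+-identityʳ _)
  ∑-attach-++ t (e ∷ es) fs ψ = begin
    ∑ (attach t (e ∷ es ++ fs)) ψ                                        ≈⟨ ∑-attach-∷ t e (es ++ fs) ψ ⟩
    ∑ (attachEdge t e) (λ e′ → ∑ (attach t (es ++ fs)) _)
      ≈⟨ ∑-cong (attachEdge t e) (λ e′ → ∑-attach-++ t es fs _) ⟩
    ∑ (attachEdge t e) (λ e′ → ∑ (attach t es) (λ es′ → ∑ (attach t fs) _)) ≈⟨ ∑-attach-∷ t e es _ ⟨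
    ∑ (attach t (e ∷ es)) (λ es′ → ∑ (attach t fs) _)                    ∎

  -- The first-round choice for `b` and the second-round choice for `a` are independent.
  -- Interchanging their sums puts both rounds for each end side by side, where `concatMap` merges
  -- them.
  ∑-attachEdge-bind : ∀ (t : X → List Y) (s : Y → List Z) e χ →
    ∑ (attachEdge t e) (λ e′ → ∑ (attachEdge s e′) χ) ≈ ∑ (attachEdge (concatMap s ∘ t) e) χ
  ∑-attachEdge-bind t s (a , b) χ = begin
    ∑ (attachEdge t (a , b)) (λ e′ → ∑ (attachEdge s e′) χ)
      ≈⟨ ∑-attachEdge t a b _ ⟩
    ∑ (t a) (λ a′ → ∑ (t b) (λ b′ → ∑ (attachEdge s (a′ , b′)) χ))
      ≈⟨ ∑-cong (t a) (λ a′ → ∑-cong (t b) (λ b′ → ∑-attachEdge s a′ b′ χ)) ⟩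
    ∑ (t a) (λ a′ → ∑ (t b) (λ b′ → ∑ (s a′) (λ a″ → ∑ (s b′) (λ b″ → χ (a″ , b″)))))
      ≈⟨ ∑-cong (t a) (λ a′ → ∑-swap (t b) (s a′) _) ⟩
    ∑ (t a) (λ a′ → ∑ (s a′) (λ a″ → ∑ (t b) (λ b′ → ∑ (s b′) (λ b″ → χ (a″ , b″)))))
      ≈⟨ ∑-cong (t a) (λ a′ → ∑-cong (s a′) (λ a″ → ∑-concatMap s (t b) _)) ⟨
    ∑ (t a) (λ a′ → ∑ (s a′) (λ a″ → ∑ (concatMap s (t b)) (λ b″ → χ (a″ , b″))))
      ≈⟨ ∑-concatMap s (t a) _ ⟨
    ∑ (concatMap s (t a)) (λ a″ → ∑ (concatMap s (t b)) (λ b″ → χ (a″ , b″)))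
      ≈⟨ ∑-attachEdge (concatMap s ∘ t) a b χ ⟨
    ∑ (attachEdge (concatMap s ∘ t) (a , b)) χ ∎

  -- The same interchange one level up: the first round for the remaining edges moves past the
  -- second round for `e`.
  ∑-attach-bind : ∀ (t : X → List Y) (s : Y → List Z) es ψ →
    ∑ (attach t es) (λ es′ → ∑ (attach s es′) ψ) ≈ ∑ (attach (concatMap s ∘ t) es) ψ
  ∑-attach-bind t s []       ψ = +-identityʳ _
  ∑-attach-bind t s (e ∷ es) ψ = begin
    ∑ (attach t (e ∷ es)) (λ es′ → ∑ (attach s es′) ψ)
      ≈⟨ ∑-attach-∷ t e es _ ⟩
    ∑ (attachEdge t e) (λ e′ → ∑ (attach t es) (λ es′ → ∑ (attach s (e′ ∷ es′)) ψ))
      ≈⟨ ∑-cong (attachEdge t e) (λ e′ → ∑-cong (attach t es) (λ es′ → ∑-attach-∷ s e′ es′ ψ)) ⟩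
    ∑ (attachEdge t e) (λ e′ → ∑ (attach t es) (λ es′ → ∑ (attachEdge s e′) (λ e″ → ∑ (attach s es′) (λ es″ → ψ (e″ ∷ es″)))))
      ≈⟨ ∑-cong (attachEdge t e) (λ e′ → ∑-swap (attach t es) (attachEdge s e′) _) ⟩
    ∑ (attachEdge t e) (λ e′ → ∑ (attachEdge s e′) (λ e″ → ∑ (attach t es) (λ es′ → ∑ (attach s es′) (λ es″ → ψ (e″ ∷ es″)))))
      ≈⟨ ∑-attachEdge-bind t s e _ ⟩
    ∑ (attachEdge (concatMap s ∘ t) e) (λ e″ → ∑ (attach t es) (λ es′ → ∑ (attach s es′) (λ es″ → ψ (e″ ∷ es″))))
      ≈⟨ ∑-cong (attachEdge (concatMap s ∘ t) e) (λ e″ → ∑-attach-bind t s es _) ⟩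
    ∑ (attachEdge (concatMap s ∘ t) e) (λ e″ → ∑ (attach (concatMap s ∘ t) es) (λ es″ → ψ (e″ ∷ es″)))
      ≈⟨ ∑-attach-∷ (concatMap s ∘ t) e es ψ ⟨
    ∑ (attach (concatMap s ∘ t) (e ∷ es)) ψ ∎

  ∑-attach-pure : ∀ (f : X → Y) es ψ → ∑ (attach ([_] ∘ f) es) ψ ≈ ψ (map (relabelEdge f) es)
  ∑-attach-pure f []       ψ = +-identityʳ _
  ∑-attach-pure f (e ∷ es) ψ = begin
    ∑ (attach ([_] ∘ f) (e ∷ es)) ψ                                 ≈⟨ ∑-attach-∷ ([_] ∘ f) e es ψ ⟩
    ∑ [ relabelEdge f e ] (λ e′ → ∑ (attach ([_] ∘ f) es) (λ es′ → ψ (e′ ∷ es′))) ≈⟨ +-identityʳ _ ⟩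
    ∑ (attach ([_] ∘ f) es) (λ es′ → ψ (relabelEdge f e ∷ es′))     ≈⟨ ∑-attach-pure f es _ ⟩
    ψ (map (relabelEdge f) (e ∷ es))                                ∎

  -- A relabelling is a reattachment with exactly one choice per end, so this is an instance of
  -- merging two rounds.
  ∑-attach-map : ∀ (t : X → List Y) (f : Y → Z) es ψ →
    ∑ (attach t es) (λ es′ → ψ (map (relabelEdge f) es′)) ≈ ∑ (attach (map f ∘ t) es) ψ
  ∑-attach-map t f es ψ = begin
    ∑ (attach t es) (λ es′ → ψ (map (relabelEdge f) es′))
      ≈⟨ ∑-cong (attach t es) (λ es′ → ∑-attach-pure f es′ ψ) ⟨
    ∑ (attach t es) (λ es′ → ∑ (attach ([_] ∘ f) es′) ψ)        ≈⟨ ∑-attach-bind t ([_] ∘ f) es ψ ⟩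
    ∑ (attach (concatMap ([_] ∘ f) ∘ t) es) ψ
      ≈⟨ ∑-attach-≐ {t = concatMap ([_] ∘ f) ∘ t} {map f ∘ t} concatMap≐map es ψ ⟩
    ∑ (attach (map f ∘ t) es) ψ                                 ∎
    where
    concatMap≐map : concatMap ([_] ∘ f) ∘ t ≐ map f ∘ t
    concatMap≐map a φ = begin
      ∑ (concatMap ([_] ∘ f) (t a)) φ   ≈⟨ ∑-concatMap ([_] ∘ f) (t a) φ ⟩
      ∑ (t a) (λ b → ∑ [ f b ] φ)       ≈⟨ ∑-cong (t a) (λ b → +-identityʳ _) ⟩
      ∑ (t a) (φ ∘ f)                   ≈⟨ ∑-map f (t a) φ ⟨
      ∑ (map f (t a)) φ                 ∎

  ∑-attach-relabel : ∀ (t : Y → List Z) (f : X → Y) es ψ →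
    ∑ (attach t (map (relabelEdge f) es)) ψ ≈ ∑ (attach (t ∘ f) es) ψ
  ∑-attach-relabel t f es ψ = reflexive (≡.cong (λ l → ∑ l ψ) (attach-relabel t f es))

  -- For a flipped edge, interchange the sums over its two ends and flip each resulting edge back by
  -- invariance of `χ`.
  ∑-attachEdge-≈ᴱ : ∀ (t : X → List Y) {e f χ} → Congruent _≈ᴱ_ _≈_ χ → e ≈ᴱ f →
                    ∑ (attachEdge t e) χ ≈ ∑ (attachEdge t f) χ
  ∑-attachEdge-≈ᴱ t χ-inv (inj₁ (≡.refl , ≡.refl)) = refl
  ∑-attachEdge-≈ᴱ t {a , b} {_} {χ} χ-inv (inj₂ (≡.refl , ≡.refl)) = begin
    ∑ (attachEdge t (a , b)) χ                          ≈⟨ ∑-attachEdge t a b χ ⟩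
    ∑ (t a) (λ a′ → ∑ (t b) (λ b′ → χ (a′ , b′)))       ≈⟨ ∑-swap (t a) (t b) _ ⟩
    ∑ (t b) (λ b′ → ∑ (t a) (λ a′ → χ (a′ , b′)))
      ≈⟨ ∑-cong (t b) (λ b′ → ∑-cong (t a) (λ a′ → χ-inv (inj₂ (≡.refl , ≡.refl)))) ⟩
    ∑ (t b) (λ b′ → ∑ (t a) (λ a′ → χ (b′ , a′)))       ≈⟨ ∑-attachEdge t b a χ ⟨
    ∑ (attachEdge t (b , a)) χ                          ∎

  private
    ∑-attach-∷-cong : ∀ (t : X → List Y) {e f} es fs {ψ} → Congruent _↭ᴱ_ _≈_ ψ → e ≈ᴱ f →
      -- Quantified over `ψ` because the tails are compared under the functions that first prepend a
      -- chosen edge `e′`.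
      (∀ {ψ} → Congruent _↭ᴱ_ _≈_ ψ → ∑ (attach t es) ψ ≈ ∑ (attach t fs) ψ) →
      ∑ (attach t (e ∷ es)) ψ ≈ ∑ (attach t (f ∷ fs)) ψ
    ∑-attach-∷-cong t {e} {f} es fs {ψ} ψ-inv e≈f es≈fs = begin
      ∑ (attach t (e ∷ es)) ψ                          ≈⟨ ∑-attach-∷ t e es ψ ⟩
      ∑ (attachEdge t e) (λ e′ → ∑ (attach t es) _)
        ≈⟨ ∑-cong (attachEdge t e) (λ e′ → es≈fs (ψ-inv ∘ Homogeneous.prep ≈ᴱ-refl)) ⟩
      ∑ (attachEdge t e) (λ e′ → ∑ (attach t fs) _)
        ≈⟨ ∑-attachEdge-≈ᴱ t
             (λ e≈f → ∑-cong (attach t fs) (λ fs′ → ψ-inv (Homogeneous.prep e≈f ↭ᴱ-refl))) e≈f ⟩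
      ∑ (attachEdge t f) (λ f′ → ∑ (attach t fs) _)    ≈⟨ ∑-attach-∷ t f fs ψ ⟨
      ∑ (attach t (f ∷ fs)) ψ                          ∎

    ∑-attach-swap : ∀ (t : X → List Y) e f es {ψ} → Congruent _↭ᴱ_ _≈_ ψ →
      ∑ (attach t (e ∷ f ∷ es)) ψ ≈ ∑ (attach t (f ∷ e ∷ es)) ψ
    ∑-attach-swap t e f es {ψ} ψ-inv = begin
      ∑ (attach t (e ∷ f ∷ es)) ψ
        ≈⟨ unfold e f ψ ⟩
      ∑ (attachEdge t e) (λ e′ → ∑ (attachEdge t f) (λ f′ → ∑ (attach t es) (λ es′ → ψ (e′ ∷ f′ ∷ es′))))
        ≈⟨ ∑-swap (attachEdge t e) (attachEdge t f) _ ⟩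
      ∑ (attachEdge t f) (λ f′ → ∑ (attachEdge t e) (λ e′ → ∑ (attach t es) (λ es′ → ψ (e′ ∷ f′ ∷ es′))))
        ≈⟨ ∑-cong (attachEdge t f) (λ f′ → ∑-cong (attachEdge t e) (λ e′ → ∑-cong (attach t es) (λ es′ →
             ψ-inv (Homogeneous.swap ≈ᴱ-refl ≈ᴱ-refl ↭ᴱ-refl)))) ⟩
      ∑ (attachEdge t f) (λ f′ → ∑ (attachEdge t e) (λ e′ → ∑ (attach t es) (λ es′ → ψ (f′ ∷ e′ ∷ es′))))
        ≈⟨ unfold f e ψ ⟨
      ∑ (attach t (f ∷ e ∷ es)) ψ ∎
      where
      unfold : ∀ e f ψ → ∑ (attach t (e ∷ f ∷ es)) ψ ≈
        ∑ (attachEdge t e) (λ e′ → ∑ (attachEdge t f) (λ f′ → ∑ (attach t es) (λ es′ → ψ (e′ ∷ f′ ∷ es′))))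
      unfold e f ψ = trans (∑-attach-∷ t e (f ∷ es) ψ) (∑-cong (attachEdge t e) (λ e′ → ∑-attach-∷ t f es _))

  -- Makes reattachment well defined on multisets of unordered pairs. Setoid permutations change
  -- edges up to `≈ᴱ` even in the `refl` constructor, which is why that constructor needs its own
  -- recursion.
  ∑-attach-↭ : ∀ (t : X → List Y) {es fs ψ} → Congruent _↭ᴱ_ _≈_ ψ → es ↭ᴱ fs →
               ∑ (attach t es) ψ ≈ ∑ (attach t fs) ψ
  ∑-attach-↭ t ψ-inv (Homogeneous.refl [])                          = refl
  ∑-attach-↭ t ψ-inv (Homogeneous.refl {_ ∷ es} {_ ∷ fs} (e≈f ∷ p)) =
    ∑-attach-∷-cong t es fs ψ-inv e≈f λ ψ-inv → ∑-attach-↭ t ψ-inv (Homogeneous.refl p)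
  ∑-attach-↭ t ψ-inv (Homogeneous.prep {es} {fs} e≈f p)             =
    ∑-attach-∷-cong t es fs ψ-inv e≈f λ ψ-inv → ∑-attach-↭ t ψ-inv p
  ∑-attach-↭ t ψ-inv (Homogeneous.swap {es} {fs} {x} {y} {x′} {y′} x≈x′ y≈y′ p) = trans
    (∑-attach-∷-cong t (y ∷ es) (y′ ∷ fs) ψ-inv x≈x′ λ ψ-inv →
      ∑-attach-∷-cong t es fs ψ-inv y≈y′ λ ψ-inv → ∑-attach-↭ t ψ-inv p)
    (∑-attach-swap t x′ y′ fs ψ-inv)
  ∑-attach-↭ t ψ-inv (Homogeneous.trans p q)                        =
    trans (∑-attach-↭ t ψ-inv p) (∑-attach-↭ t ψ-inv q)

  -- The common core of both associativity axioms. Ends in `es`, from the outer graph, undergo both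
  -- rounds; ends in `fs`, from the graph inserted first, undergo only the second. The map `f` is
  -- the rearrangement of vertices between the rounds, and `g` embeds the inserted vertices.
  ∑-attach-attach : ∀ {W X′ : Set} (t : X → List Y) (s : Z → List W) (f : Y → Z) (g : X′ → Y) es fs χ →
    ∑ (attach t es) (λ es′ → ∑ (attach s (map (relabelEdge f) (es′ ++ map (relabelEdge g) fs))) χ) ≈
    ∑ (attach (concatMap (s ∘ f) ∘ t) es) (λ es′ → ∑ (attach (s ∘ f ∘ g) fs) (λ fs′ → χ (es′ ++ fs′)))
  ∑-attach-attach t s f g es fs χ = begin
    ∑ (attach t es) (λ es′ → ∑ (attach s (map (relabelEdge f) (es′ ++ map (relabelEdge g) fs))) χ)
      ≈⟨ ∑-cong (attach t es) (λ es′ → ∑-attach-relabel s f (es′ ++ _) χ) ⟩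
    ∑ (attach t es) (λ es′ → ∑ (attach (s ∘ f) (es′ ++ map (relabelEdge g) fs)) χ)
      ≈⟨ ∑-cong (attach t es) (λ es′ → ∑-attach-++ (s ∘ f) es′ _ χ) ⟩
    ∑ (attach t es) (λ es′ → ∑ (attach (s ∘ f) es′) (λ es″ → ∑ (attach (s ∘ f) (map (relabelEdge g) fs)) (λ fs′ → χ (es″ ++ fs′))))
      ≈⟨ ∑-attach-bind t (s ∘ f) es _ ⟩
    ∑ (attach (concatMap (s ∘ f) ∘ t) es) (λ es″ → ∑ (attach (s ∘ f) (map (relabelEdge g) fs)) (λ fs′ → χ (es″ ++ fs′)))
      ≈⟨ ∑-cong (attach (concatMap (s ∘ f) ∘ t) es) (λ es″ → ∑-attach-relabel (s ∘ f) g fs _) ⟩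
    ∑ (attach (concatMap (s ∘ f) ∘ t) es) (λ es″ → ∑ (attach (s ∘ f ∘ g) fs) (λ fs′ → χ (es″ ++ fs′))) ∎

  ∑-concatMap-map : ∀ {X Y Z : Set} (f : Y → List Z) (g : X → Y) xs φ →
                    ∑ (concatMap f (map g xs)) φ ≈ ∑ xs (λ x → ∑ (f (g x)) φ)
  ∑-concatMap-map f g xs φ = trans (∑-concatMap f (map g xs) φ) (∑-map g xs _)

  ∑-elements-⊕ : ∀ V W φ →
    ∑ (elements (V ⊕ W)) φ ≈ ∑ (elements V) (φ ∘ inj₁) + ∑ (elements W) (φ ∘ inj₂)
  ∑-elements-⊕ V W φ = begin
    ∑ (elements (V ⊕ W)) φ                                         ≈⟨ ∑-↭ (elements-⊕ V W) φ ⟩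
    ∑ (map inj₁ (elements V) ++ map inj₂ (elements W)) φ           ≈⟨ ∑-++ (map inj₁ (elements V)) _ φ ⟩
    ∑ (map inj₁ (elements V)) φ + ∑ (map inj₂ (elements W)) φ
      ≈⟨ +-cong (∑-map inj₁ (elements V) φ) (∑-map inj₂ (elements W) φ) ⟩
    ∑ (elements V) (φ ∘ inj₁) + ∑ (elements W) (φ ∘ inj₂)          ∎

  -- The axioms for a single end

  reattachEnd-natural : ∀ {V₁ V₂ W₁ W₂} (σ : V₁ ≅ W₁) (τ : V₂ ≅ W₂) →
    map (to (σ ⊕-≅ τ)) ∘ reattachEnd V₁ V₂ ≐ reattachEnd W₁ W₂ ∘ to (σ ⊕-≅ ≅-id {𝟙})
  reattachEnd-natural σ τ (inj₁ v) φ = refl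
  reattachEnd-natural {V₁} {V₂} {W₁} {W₂} σ τ (inj₂ tt) φ = begin
    ∑ (map (to (σ ⊕-≅ τ)) (map inj₂ (elements V₂))) φ   ≈⟨ ∑-map (to (σ ⊕-≅ τ)) (map inj₂ (elements V₂)) φ ⟩
    ∑ (map inj₂ (elements V₂)) (φ ∘ to (σ ⊕-≅ τ))       ≈⟨ ∑-map inj₂ (elements V₂) _ ⟩
    ∑ (elements V₂) (φ ∘ inj₂ ∘ to τ)                   ≈⟨ ∑-map (to τ) (elements V₂) _ ⟨
    ∑ (map (to τ) (elements V₂)) (φ ∘ inj₂)             ≈⟨ ∑-↭ (elements-≅ τ) _ ⟨
    ∑ (elements W₂) (φ ∘ inj₂)                          ≈⟨ ∑-map inj₂ (elements W₂) φ ⟨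
    ∑ (map inj₂ (elements W₂)) φ                        ∎

  -- Each adjoined point is expanded in exactly one round and contributes a single choice in the
  -- other, so the two orders differ only by singletons and a trailing `++ []`.
  reattachEnd-parallel : ∀ V₁ V₂ V₃ →
    concatMap (reattachEnd (V₁ ⊕ V₂) V₃ ∘ to (exchange V₁ 𝟙 V₂)) ∘ reattachEnd (V₁ ⊕ 𝟙) V₂ ≐
    map (to (exchange V₁ V₃ V₂)) ∘ concatMap (reattachEnd (V₁ ⊕ V₃) V₂ ∘ to (exchange V₁ 𝟙 V₃)) ∘
      reattachEnd (V₁ ⊕ 𝟙) V₃ ∘ to (exchange V₁ 𝟙 𝟙)
  reattachEnd-parallel V₁ V₂ V₃ (inj₁ (inj₁ v)) φ = refl
  reattachEnd-parallel V₁ V₂ V₃ (inj₁ (inj₂ tt)) φ = begin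
    ∑ (map inj₂ (elements V₃) ++ []) φ
      ≈⟨ trans (∑-++ (map inj₂ (elements V₃)) [] φ) (+-identityʳ _) ⟩
    ∑ (map inj₂ (elements V₃)) φ
      ≈⟨ ∑-map inj₂ (elements V₃) φ ⟩
    ∑ (elements V₃) (φ ∘ inj₂)
      ≈⟨ ∑-cong (elements V₃) (λ v → +-identityʳ _) ⟨
    ∑ (elements V₃) (λ v → ∑ [ inj₁ (inj₂ v) ] (φ ∘ to (exchange V₁ V₃ V₂)))
      ≈⟨ ∑-concatMap-map (reattachEnd (V₁ ⊕ V₃) V₂ ∘ to (exchange V₁ 𝟙 V₃)) inj₂ (elements V₃) _ ⟨
    ∑ (concatMap (reattachEnd (V₁ ⊕ V₃) V₂ ∘ to (exchange V₁ 𝟙 V₃)) (map inj₂ (elements V₃))) (φ ∘ to (exchange V₁ V₃ V₂))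
      ≈⟨ ∑-map (to (exchange V₁ V₃ V₂)) (concatMap (reattachEnd (V₁ ⊕ V₃) V₂ ∘ to (exchange V₁ 𝟙 V₃)) (map inj₂ (elements V₃))) φ ⟨
    ∑ (map (to (exchange V₁ V₃ V₂)) (concatMap (reattachEnd (V₁ ⊕ V₃) V₂ ∘ to (exchange V₁ 𝟙 V₃)) (map inj₂ (elements V₃)))) φ ∎
  reattachEnd-parallel V₁ V₂ V₃ (inj₂ tt) φ = begin
    ∑ (concatMap (reattachEnd (V₁ ⊕ V₂) V₃ ∘ to (exchange V₁ 𝟙 V₂)) (map inj₂ (elements V₂))) φ
      ≈⟨ ∑-concatMap-map (reattachEnd (V₁ ⊕ V₂) V₃ ∘ to (exchange V₁ 𝟙 V₂)) inj₂ (elements V₂) φ ⟩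
    ∑ (elements V₂) (λ v → ∑ [ inj₁ (inj₂ v) ] φ)
      ≈⟨ ∑-cong (elements V₂) (λ v → +-identityʳ _) ⟩
    ∑ (elements V₂) (φ ∘ inj₁ ∘ inj₂)
      ≈⟨ ∑-map inj₂ (elements V₂) _ ⟨
    ∑ (map inj₂ (elements V₂)) (φ ∘ to (exchange V₁ V₃ V₂))
      ≈⟨ trans (∑-++ (map inj₂ (elements V₂)) [] _) (+-identityʳ _) ⟨
    ∑ (map inj₂ (elements V₂) ++ []) (φ ∘ to (exchange V₁ V₃ V₂))
      ≈⟨ ∑-map (to (exchange V₁ V₃ V₂)) (map inj₂ (elements V₂) ++ []) φ ⟨
    ∑ (map (to (exchange V₁ V₃ V₂)) (map inj₂ (elements V₂) ++ [])) φ ∎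

  reattachEnd-sequential : ∀ V₁ V₂ V₃ →
    map (to (assocʳ V₁ V₂ V₃)) ∘ concatMap (reattachEnd (V₁ ⊕ V₂) V₃ ∘ to (assocˡ V₁ V₂ 𝟙)) ∘
      reattachEnd V₁ (V₂ ⊕ 𝟙) ≐
    reattachEnd V₁ (V₂ ⊕ V₃)
  reattachEnd-sequential V₁ V₂ V₃ (inj₁ v) φ = refl
  reattachEnd-sequential V₁ V₂ V₃ (inj₂ tt) φ = begin
    ∑ (map α (concatMap t (map inj₂ (elements (V₂ ⊕ 𝟙))))) φ
      ≈⟨ ∑-map α (concatMap t (map inj₂ (elements (V₂ ⊕ 𝟙)))) φ ⟩
    ∑ (concatMap t (map inj₂ (elements (V₂ ⊕ 𝟙)))) (φ ∘ α)
      ≈⟨ ∑-concatMap-map t inj₂ (elements (V₂ ⊕ 𝟙)) _ ⟩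
    ∑ (elements (V₂ ⊕ 𝟙)) (λ v → ∑ (t (inj₂ v)) (φ ∘ α))
      -- An end sent into `V₂` stays there in the second round; an end sent to the adjoined point
      -- spreads over all of `V₃`.
      ≈⟨ ∑-elements-⊕ V₂ 𝟙 _ ⟩
    ∑ (elements V₂) (λ v → ∑ [ inj₁ (inj₂ v) ] (φ ∘ α)) + ∑ [ tt ] (λ _ → ∑ (map inj₂ (elements V₃)) (φ ∘ α))
      ≈⟨ +-cong (∑-cong (elements V₂) (λ v → +-identityʳ _)) (+-identityʳ _) ⟩
    ∑ (elements V₂) (φ ∘ inj₂ ∘ inj₁) + ∑ (map inj₂ (elements V₃)) (φ ∘ α)
      ≈⟨ +-congˡ (∑-map inj₂ (elements V₃) _) ⟩
    ∑ (elements V₂) (φ ∘ inj₂ ∘ inj₁) + ∑ (elements V₃) (φ ∘ inj₂ ∘ inj₂)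
      ≈⟨ ∑-elements-⊕ V₂ V₃ _ ⟨
    ∑ (elements (V₂ ⊕ V₃)) (φ ∘ inj₂)
      ≈⟨ ∑-map inj₂ (elements (V₂ ⊕ V₃)) φ ⟨
    ∑ (map inj₂ (elements (V₂ ⊕ V₃))) φ ∎
    where
    α = to (assocʳ V₁ V₂ V₃)
    t = reattachEnd (V₁ ⊕ V₂) V₃ ∘ to (assocˡ V₁ V₂ 𝟙)

  -- Concerns the ends of the middle graph: expanding their point after insertion into the outer
  -- graph offers the same vertices as expanding it before.
  reattachEnd-inner : ∀ V₁ V₂ V₃ →
    map (to (assocʳ V₁ V₂ V₃)) ∘ reattachEnd (V₁ ⊕ V₂) V₃ ∘ to (assocˡ V₁ V₂ 𝟙) ∘ inj₂ ≐
    map inj₂ ∘ reattachEnd V₂ V₃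
  reattachEnd-inner V₁ V₂ V₃ (inj₁ v) φ = refl
  reattachEnd-inner V₁ V₂ V₃ (inj₂ tt) φ = begin
    ∑ (map (to (assocʳ V₁ V₂ V₃)) (map inj₂ (elements V₃))) φ
      ≈⟨ ∑-map (to (assocʳ V₁ V₂ V₃)) (map inj₂ (elements V₃)) φ ⟩
    ∑ (map inj₂ (elements V₃)) (φ ∘ to (assocʳ V₁ V₂ V₃))       ≈⟨ ∑-map inj₂ (elements V₃) _ ⟩
    ∑ (elements V₃) (φ ∘ inj₂ ∘ inj₂)                           ≈⟨ ∑-map inj₂ (elements V₃) _ ⟨
    ∑ (map inj₂ (elements V₃)) (φ ∘ inj₂)                       ≈⟨ ∑-map inj₂ (map inj₂ (elements V₃)) φ ⟨
    ∑ (map inj₂ (map inj₂ (elements V₃))) φ                     ∎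

  reattachEnd-point : ∀ V₁ V v (v-only : IsOnlyElement V v) →
    reattachEnd V₁ V ≐ [_] ∘ to (≅-id {V₁} ⊕-≅ point V v v-only)
  reattachEnd-point V₁ V v v-only (inj₁ u) φ = refl
  reattachEnd-point V₁ V v v-only (inj₂ tt) φ =
    trans (∑-map inj₂ (elements V) φ) (∑-↭ (elements-point V v v-only) _)

  -- The axioms for basis graphs

  GraphInvariant : ∀ V → (Multigraph V → K) → Set _
  GraphInvariant V = Pairing.Invariant (multigraphs V)

  ∑-compose : ∀ V₁ V₂ g h φ →
    ∑ (compose V₁ V₂ g h) φ ≈ ∑ (attach (reattachEnd V₁ V₂) (edges g)) (φ ∘ glue h)
  ∑-compose V₁ V₂ g h φ = trans
    (reflexive (≡.cong (λ l → ∑ l φ) (compose-attach V₁ V₂ g h)))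
    (∑-map (glue h) (attach (reattachEnd V₁ V₂) (edges g)) φ)

  ∑-compose-congˡ : ∀ {V₁ V₂} h {φ} → GraphInvariant (V₁ ⊕ V₂) φ →
                    GraphInvariant (V₁ ⊕ 𝟙) (λ g → ∑ (compose V₁ V₂ g h) φ)
  ∑-compose-congˡ {V₁} {V₂} h {φ} φ-inv {g} {g′} g≈g′ = begin
    ∑ (compose V₁ V₂ g h) φ                                          ≈⟨ ∑-compose V₁ V₂ g h φ ⟩
    ∑ (attach (reattachEnd V₁ V₂) (edges g)) (φ ∘ glue h)
      ≈⟨ ∑-attach-↭ (reattachEnd V₁ V₂)
           (λ {es} {es′} es↭es′ → φ-inv {glue h es} {glue h es′} (++⁺ʳ _ es↭es′)) g≈g′ ⟩
    ∑ (attach (reattachEnd V₁ V₂) (edges g′)) (φ ∘ glue h)           ≈⟨ ∑-compose V₁ V₂ g′ h φ ⟨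
    ∑ (compose V₁ V₂ g′ h) φ                                         ∎
    where open PermutationProperties (edgeSetoid ⟨ V₁ ⊕ V₂ ⟩) using (++⁺ʳ)

  ∑-compose-congʳ : ∀ {V₁ V₂} g {φ} → GraphInvariant (V₁ ⊕ V₂) φ →
                    GraphInvariant V₂ (λ h → ∑ (compose V₁ V₂ g h) φ)
  ∑-compose-congʳ {V₁} {V₂} g {φ} φ-inv {h} {h′} h≈h′ = begin
    ∑ (compose V₁ V₂ g h) φ                                          ≈⟨ ∑-compose V₁ V₂ g h φ ⟩
    ∑ (attach (reattachEnd V₁ V₂) (edges g)) (φ ∘ glue h)
      ≈⟨ ∑-cong (attach (reattachEnd V₁ V₂) (edges g)) (λ es →
           φ-inv {glue h es} {glue h′ es} (++⁺ˡ es (map⁺ (edgeSetoid ⟨ V₁ ⊕ V₂ ⟩) (relabelEdge-cong inj₂) h≈h′))) ⟩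
    ∑ (attach (reattachEnd V₁ V₂) (edges g)) (φ ∘ glue h′)           ≈⟨ ∑-compose V₁ V₂ g h′ φ ⟨
    ∑ (compose V₁ V₂ g h′) φ                                         ∎
    where
    open PermutationProperties (edgeSetoid ⟨ V₁ ⊕ V₂ ⟩) using (++⁺ˡ)
    open PermutationProperties (edgeSetoid ⟨ V₂ ⟩) using (map⁺)

  -- Relabelling afterwards acts on the lists of choices, relabelling beforehand on the ends that
  -- index them; both are absorbed into `attach`, where `reattachEnd-natural` compares them.
  ∑-compose-natural : ∀ {V₁ V₂ W₁ W₂} (σ : V₁ ≅ W₁) (τ : V₂ ≅ W₂) g h {φ} → GraphInvariant (W₁ ⊕ W₂) φ →
    ∑ (compose V₁ V₂ g h) (φ ∘ relabel (σ ⊕-≅ τ)) ≈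
    ∑ (compose W₁ W₂ (relabel (σ ⊕-≅ ≅-id) g) (relabel τ h)) φ
  ∑-compose-natural {V₁} {V₂} {W₁} {W₂} σ τ g h {φ} φ-inv = begin
    ∑ (compose V₁ V₂ g h) (φ ∘ relabel (σ ⊕-≅ τ))
      ≈⟨ ∑-compose V₁ V₂ g h _ ⟩
    ∑ (attach t (edges g)) (φ ∘ relabel (σ ⊕-≅ τ) ∘ glue h)
      ≈⟨ ∑-cong (attach t (edges g)) (λ es →
           φ-inv {relabel (σ ⊕-≅ τ) (glue h es)} {glue (relabel τ h) (map (relabelEdge f) es)}
                 (↭ᴱ-reflexive (relabel-glue es))) ⟩
    ∑ (attach t (edges g)) (φ ∘ glue (relabel τ h) ∘ map (relabelEdge f))
      ≈⟨ ∑-attach-map t f (edges g) _ ⟩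
    ∑ (attach (map f ∘ t) (edges g)) (φ ∘ glue (relabel τ h))
      ≈⟨ ∑-attach-≐ {t = map f ∘ t} {s ∘ to (σ ⊕-≅ ≅-id {𝟙})} (reattachEnd-natural σ τ) (edges g) _ ⟩
    ∑ (attach (s ∘ to (σ ⊕-≅ ≅-id {𝟙})) (edges g)) (φ ∘ glue (relabel τ h))
      ≈⟨ ∑-attach-relabel s (to (σ ⊕-≅ ≅-id {𝟙})) (edges g) _ ⟨
    ∑ (attach s (edges (relabel (σ ⊕-≅ ≅-id) g))) (φ ∘ glue (relabel τ h))
      ≈⟨ ∑-compose W₁ W₂ (relabel (σ ⊕-≅ ≅-id) g) (relabel τ h) φ ⟨
    ∑ (compose W₁ W₂ (relabel (σ ⊕-≅ ≅-id) g) (relabel τ h)) φ ∎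
    where
    t = reattachEnd V₁ V₂
    s = reattachEnd W₁ W₂
    f = to (σ ⊕-≅ τ)
    relabel-glue : ∀ es → map (relabelEdge f) (es ++ map (relabelEdge inj₂) (edges h)) ≡
                          map (relabelEdge f) es ++ map (relabelEdge inj₂) (map (relabelEdge (to τ)) (edges h))
    relabel-glue es = ≡.trans (List.map-++ (relabelEdge f) es _)
      (≡.cong (map (relabelEdge f) es ++_) (≡.trans (≡.sym (List.map-∘ (edges h))) (List.map-∘ (edges h))))

  -- Both sides have the shape treated by `twice`, with the inserted graphs in opposite order. Once
  -- the choices for `f` agree, the edges of `g` and `h` still appear in opposite orders, so a
  -- genuine permutation of edges is needed here; the other axioms get by with equal edge lists.
  ∑-compose-parallel : ∀ {V₁ V₂ V₃} f g h {φ} → GraphInvariant (V₁ ⊕ V₂ ⊕ V₃) φ →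
    ∑ (compose (V₁ ⊕ 𝟙) V₂ f g) (λ f′ →
      ∑ (compose (V₁ ⊕ V₂) V₃ (relabel (exchange V₁ 𝟙 V₂) f′) h) φ) ≈
    ∑ (compose (V₁ ⊕ 𝟙) V₃ (relabel (exchange V₁ 𝟙 𝟙) f) h) (λ f′ →
      ∑ (compose (V₁ ⊕ V₃) V₂ (relabel (exchange V₁ 𝟙 V₃) f′) g) (φ ∘ relabel (exchange V₁ V₃ V₂)))
  ∑-compose-parallel {V₁} {V₂} {V₃} f g@(mkMultigraph es₂ v₂) h@(mkMultigraph es₃ v₃) {φ} φ-inv = begin
    ∑ (compose (V₁ ⊕ 𝟙) V₂ f g) (λ f′ → ∑ (compose (V₁ ⊕ V₂) V₃ (relabel (exchange V₁ 𝟙 V₂) f′) h) φ)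
      ≈⟨ twice V₂ V₃ f g h φ ⟩
    ∑ (attach (t V₂ V₃) (edges f)) (λ es → φ (glue h (es ++ map (relabelEdge (inj₁ ∘ inj₂)) es₂)))
      ≈⟨ ∑-attach-≐ {t = t V₂ V₃} {s} (reattachEnd-parallel V₁ V₂ V₃) (edges f) _ ⟩
    ∑ (attach s (edges f)) (λ es → φ (glue h (es ++ map (relabelEdge (inj₁ ∘ inj₂)) es₂)))
      ≈⟨ ∑-attach-map (t V₃ V₂ ∘ to (exchange V₁ 𝟙 𝟙)) ex (edges f) _ ⟨
    ∑ (attach (t V₃ V₂ ∘ to (exchange V₁ 𝟙 𝟙)) (edges f))
      (λ es → φ (glue h (map (relabelEdge ex) es ++ map (relabelEdge (inj₁ ∘ inj₂)) es₂)))
      ≈⟨ ∑-attach-relabel (t V₃ V₂) (to (exchange V₁ 𝟙 𝟙)) (edges f) _ ⟨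
    ∑ (attach (t V₃ V₂) (edges (relabel (exchange V₁ 𝟙 𝟙) f)))
      (λ es → φ (glue h (map (relabelEdge ex) es ++ map (relabelEdge (inj₁ ∘ inj₂)) es₂)))
      ≈⟨ ∑-cong (attach (t V₃ V₂) (edges (relabel (exchange V₁ 𝟙 𝟙) f))) (λ es →
           φ-inv {glue h (map (relabelEdge ex) es ++ map (relabelEdge (inj₁ ∘ inj₂)) es₂)}
                 {relabel (exchange V₁ V₃ V₂) (glue g (es ++ map (relabelEdge (inj₁ ∘ inj₂)) es₃))}
                 (reorder es)) ⟩
    ∑ (attach (t V₃ V₂) (edges (relabel (exchange V₁ 𝟙 𝟙) f)))
      (λ es → φ (relabel (exchange V₁ V₃ V₂) (glue g (es ++ map (relabelEdge (inj₁ ∘ inj₂)) es₃))))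
      ≈⟨ twice V₃ V₂ (relabel (exchange V₁ 𝟙 𝟙) f) h g _ ⟨
    ∑ (compose (V₁ ⊕ 𝟙) V₃ (relabel (exchange V₁ 𝟙 𝟙) f) h) (λ f′ →
      ∑ (compose (V₁ ⊕ V₃) V₂ (relabel (exchange V₁ 𝟙 V₃) f′) g) (φ ∘ relabel (exchange V₁ V₃ V₂))) ∎
    where
    ex = to (exchange V₁ V₃ V₂)

    t : ∀ V W → ⟨ V₁ ⊕ 𝟙 ⊕ 𝟙 ⟩ → List ⟨ V₁ ⊕ V ⊕ W ⟩
    t V W = concatMap (reattachEnd (V₁ ⊕ V) W ∘ to (exchange V₁ 𝟙 V)) ∘ reattachEnd (V₁ ⊕ 𝟙) V

    s : ⟨ V₁ ⊕ 𝟙 ⊕ 𝟙 ⟩ → List ⟨ V₁ ⊕ V₂ ⊕ V₃ ⟩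
    s = map ex ∘ t V₃ V₂ ∘ to (exchange V₁ 𝟙 𝟙)

    twice : ∀ V W f (g : Multigraph V) (h : Multigraph W) φ →
      ∑ (compose (V₁ ⊕ 𝟙) V f g) (λ f′ → ∑ (compose (V₁ ⊕ V) W (relabel (exchange V₁ 𝟙 V) f′) h) φ) ≈
      ∑ (attach (t V W) (edges f)) (λ es → φ (glue h (es ++ map (relabelEdge (inj₁ ∘ inj₂)) (edges g))))
    twice V W f g h φ = begin
      ∑ (compose (V₁ ⊕ 𝟙) V f g) (λ f′ → ∑ (compose (V₁ ⊕ V) W (relabel (exchange V₁ 𝟙 V) f′) h) φ)
        ≈⟨ ∑-compose (V₁ ⊕ 𝟙) V f g _ ⟩
      ∑ (attach (reattachEnd (V₁ ⊕ 𝟙) V) (edges f)) (λ es →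
        ∑ (compose (V₁ ⊕ V) W (relabel (exchange V₁ 𝟙 V) (glue g es)) h) φ)
        ≈⟨ ∑-cong (attach (reattachEnd (V₁ ⊕ 𝟙) V) (edges f)) (λ es →
             ∑-compose (V₁ ⊕ V) W (relabel (exchange V₁ 𝟙 V) (glue g es)) h φ) ⟩
      ∑ (attach (reattachEnd (V₁ ⊕ 𝟙) V) (edges f)) (λ es →
        ∑ (attach (reattachEnd (V₁ ⊕ V) W) (edges (relabel (exchange V₁ 𝟙 V) (glue g es)))) (φ ∘ glue h))
        ≈⟨ ∑-attach-attach (reattachEnd (V₁ ⊕ 𝟙) V) (reattachEnd (V₁ ⊕ V) W) (to (exchange V₁ 𝟙 V)) inj₂
             (edges f) (edges g) (φ ∘ glue h) ⟩
      ∑ (attach (t V W) (edges f)) (λ es →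
        ∑ (attach ([_] ∘ inj₁ ∘ inj₂) (edges g)) (λ es′ → φ (glue h (es ++ es′))))
        -- No end of `g` lies at the remaining point, so the second round leaves each of them one
        -- choice.
        ≈⟨ ∑-cong (attach (t V W) (edges f)) (λ es → ∑-attach-pure (inj₁ ∘ inj₂) (edges g) _) ⟩
      ∑ (attach (t V W) (edges f)) (λ es → φ (glue h (es ++ map (relabelEdge (inj₁ ∘ inj₂)) (edges g)))) ∎

    reorder : ∀ es →
      (map (relabelEdge ex) es ++ map (relabelEdge (inj₁ ∘ inj₂)) es₂) ++ map (relabelEdge inj₂) es₃ ↭ᴱ
      map (relabelEdge ex) ((es ++ map (relabelEdge (inj₁ ∘ inj₂)) es₃) ++ map (relabelEdge inj₂) es₂)
    reorder es = ↭-trans (↭ᴱ-reflexive (List.++-assoc (map (relabelEdge ex) es) _ _))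
      (↭-trans (++⁺ˡ (map (relabelEdge ex) es) (++-comm (map (relabelEdge (inj₁ ∘ inj₂)) es₂) _))
      (↭ᴱ-reflexive (≡.sym unfold)))
      where
      open Permutation (edgeSetoid ⟨ V₁ ⊕ V₂ ⊕ V₃ ⟩) using (↭-trans)
      open PermutationProperties (edgeSetoid ⟨ V₁ ⊕ V₂ ⊕ V₃ ⟩) using (++⁺ˡ; ++-comm)
      unfold : map (relabelEdge ex) ((es ++ map (relabelEdge (inj₁ ∘ inj₂)) es₃) ++ map (relabelEdge inj₂) es₂) ≡
               map (relabelEdge ex) es ++ map (relabelEdge inj₂) es₃ ++ map (relabelEdge (inj₁ ∘ inj₂)) es₂
      unfold = ≡.trans (≡.cong (map (relabelEdge ex)) (List.++-assoc es _ _))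
        (≡.trans (List.map-++ (relabelEdge ex) es _)
          (≡.cong (map (relabelEdge ex) es ++_)
            (≡.trans (List.map-++ (relabelEdge ex) (map (relabelEdge (inj₁ ∘ inj₂)) es₃) _)
              (≡.cong₂ _++_ (≡.sym (List.map-∘ es₃)) (≡.sym (List.map-∘ es₂))))))

  -- The two rounds for the ends of `f` collapse to one round into `V₂ ⊕ V₃`, while the ends of `g`
  -- undergo just the round into `V₃`. The two families of choices are independent, so composing `g`
  -- with `h` first yields the same sum.
  ∑-compose-sequential : ∀ {V₁ V₂ V₃} f g h {φ} → GraphInvariant (V₁ ⊕ (V₂ ⊕ V₃)) φ →
    ∑ (compose V₁ (V₂ ⊕ 𝟙) f g) (λ f′ →
      ∑ (compose (V₁ ⊕ V₂) V₃ (relabel (assocˡ V₁ V₂ 𝟙) f′) h) (φ ∘ relabel (assocʳ V₁ V₂ V₃))) ≈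
    ∑ (compose V₂ V₃ g h) (λ g′ → ∑ (compose V₁ (V₂ ⊕ V₃) f g′) φ)
  ∑-compose-sequential {V₁} {V₂} {V₃} f g h@(mkMultigraph es₃ v₃) {φ} φ-inv = begin
    ∑ (compose V₁ (V₂ ⊕ 𝟙) f g) (λ f′ →
      ∑ (compose (V₁ ⊕ V₂) V₃ (relabel (assocˡ V₁ V₂ 𝟙) f′) h) (φ ∘ relabel (assocʳ V₁ V₂ V₃)))
      ≈⟨ ∑-compose V₁ (V₂ ⊕ 𝟙) f g _ ⟩
    ∑ (attach outer (edges f)) (λ es →
      ∑ (compose (V₁ ⊕ V₂) V₃ (relabel (assocˡ V₁ V₂ 𝟙) (glue g es)) h) (φ ∘ relabel (assocʳ V₁ V₂ V₃)))
      ≈⟨ ∑-cong (attach outer (edges f)) (λ es →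
           ∑-compose (V₁ ⊕ V₂) V₃ (relabel (assocˡ V₁ V₂ 𝟙) (glue g es)) h _) ⟩
    ∑ (attach outer (edges f)) (λ es →
      ∑ (attach (reattachEnd (V₁ ⊕ V₂) V₃) (edges (relabel (assocˡ V₁ V₂ 𝟙) (glue g es))))
        (φ ∘ relabel (assocʳ V₁ V₂ V₃) ∘ glue h))
      ≈⟨ ∑-attach-attach outer (reattachEnd (V₁ ⊕ V₂) V₃) (to (assocˡ V₁ V₂ 𝟙)) inj₂ (edges f) (edges g) _ ⟩
    ∑ (attach (concatMap middle ∘ outer) (edges f)) (λ es →
      ∑ (attach (middle ∘ inj₂) (edges g)) (λ es′ → φ (relabel (assocʳ V₁ V₂ V₃) (glue h (es ++ es′)))))
      ≈⟨ ∑-cong (attach (concatMap middle ∘ outer) (edges f)) (λ es → ∑-cong (attach (middle ∘ inj₂) (edges g)) (λ es′ →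
           φ-inv {relabel (assocʳ V₁ V₂ V₃) (glue h (es ++ es′))} {ψ (map (relabelEdge α) es) (map (relabelEdge α) es′)}
                 (↭ᴱ-reflexive (distribute es es′)))) ⟩
    ∑ (attach (concatMap middle ∘ outer) (edges f)) (λ es →
      ∑ (attach (middle ∘ inj₂) (edges g)) (λ es′ → φ (ψ (map (relabelEdge α) es) (map (relabelEdge α) es′))))
      ≈⟨ ∑-attach-map (concatMap middle ∘ outer) α (edges f) _ ⟩
    ∑ (attach (map α ∘ concatMap middle ∘ outer) (edges f)) (λ es →
      ∑ (attach (middle ∘ inj₂) (edges g)) (λ es′ → φ (ψ es (map (relabelEdge α) es′))))
      ≈⟨ ∑-attach-≐ {t = map α ∘ concatMap middle ∘ outer} {reattachEnd V₁ (V₂ ⊕ V₃)}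
           (reattachEnd-sequential V₁ V₂ V₃) (edges f) _ ⟩
    ∑ (attach (reattachEnd V₁ (V₂ ⊕ V₃)) (edges f)) (λ es →
      ∑ (attach (middle ∘ inj₂) (edges g)) (λ es′ → φ (ψ es (map (relabelEdge α) es′))))
      ≈⟨ ∑-cong (attach (reattachEnd V₁ (V₂ ⊕ V₃)) (edges f)) (λ es → inner (λ es′ → φ (ψ es es′))) ⟩
    ∑ (attach (reattachEnd V₁ (V₂ ⊕ V₃)) (edges f)) (λ es →
      ∑ (attach (reattachEnd V₂ V₃) (edges g)) (λ es′ → φ (ψ es (map (relabelEdge inj₂) es′))))
      -- On the right-hand side the choices for `g` are made before those for `f`.
      ≈⟨ ∑-swap (attach (reattachEnd V₁ (V₂ ⊕ V₃)) (edges f)) (attach (reattachEnd V₂ V₃) (edges g)) _ ⟩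
    ∑ (attach (reattachEnd V₂ V₃) (edges g)) (λ es′ →
      ∑ (attach (reattachEnd V₁ (V₂ ⊕ V₃)) (edges f)) (λ es → φ (ψ es (map (relabelEdge inj₂) es′))))
      ≈⟨ ∑-cong (attach (reattachEnd V₂ V₃) (edges g)) (λ es′ → ∑-cong (attach (reattachEnd V₁ (V₂ ⊕ V₃)) (edges f)) (λ es →
           φ-inv {ψ es (map (relabelEdge inj₂) es′)} {glue (glue h es′) es} (↭ᴱ-reflexive (collect es es′)))) ⟩
    ∑ (attach (reattachEnd V₂ V₃) (edges g)) (λ es′ →
      ∑ (attach (reattachEnd V₁ (V₂ ⊕ V₃)) (edges f)) (φ ∘ glue (glue h es′)))
      ≈⟨ ∑-cong (attach (reattachEnd V₂ V₃) (edges g)) (λ es′ → ∑-compose V₁ (V₂ ⊕ V₃) f (glue h es′) φ) ⟨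
    ∑ (attach (reattachEnd V₂ V₃) (edges g)) (λ es′ → ∑ (compose V₁ (V₂ ⊕ V₃) f (glue h es′)) φ)
      ≈⟨ ∑-compose V₂ V₃ g h _ ⟨
    ∑ (compose V₂ V₃ g h) (λ g′ → ∑ (compose V₁ (V₂ ⊕ V₃) f g′) φ) ∎
    where
    α = to (assocʳ V₁ V₂ V₃)
    outer = reattachEnd V₁ (V₂ ⊕ 𝟙)

    middle : ⟨ V₁ ⊕ (V₂ ⊕ 𝟙) ⟩ → List ⟨ V₁ ⊕ V₂ ⊕ V₃ ⟩
    middle = reattachEnd (V₁ ⊕ V₂) V₃ ∘ to (assocˡ V₁ V₂ 𝟙)

    -- The normal form to which both sides are brought: edges stemming from `f`, from `g` and from
    -- `h`, in this order.
    ψ : List (Edge ⟨ V₁ ⊕ (V₂ ⊕ V₃) ⟩) → List (Edge ⟨ V₁ ⊕ (V₂ ⊕ V₃) ⟩) → Multigraph (V₁ ⊕ (V₂ ⊕ V₃))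
    ψ es es′ = mkMultigraph (es ++ es′ ++ map (relabelEdge (inj₂ ∘ inj₂)) es₃) (inj₂ (inj₂ v₃))

    inner : ∀ χ → ∑ (attach (middle ∘ inj₂) (edges g)) (λ es → χ (map (relabelEdge α) es)) ≈
                  ∑ (attach (reattachEnd V₂ V₃) (edges g)) (λ es → χ (map (relabelEdge inj₂) es))
    inner χ = begin
      ∑ (attach (middle ∘ inj₂) (edges g)) (λ es → χ (map (relabelEdge α) es))
        ≈⟨ ∑-attach-map (middle ∘ inj₂) α (edges g) χ ⟩
      ∑ (attach (map α ∘ middle ∘ inj₂) (edges g)) χ
        ≈⟨ ∑-attach-≐ {t = map α ∘ middle ∘ inj₂} {map inj₂ ∘ reattachEnd V₂ V₃} (reattachEnd-inner V₁ V₂ V₃) (edges g) χ ⟩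
      ∑ (attach (map inj₂ ∘ reattachEnd V₂ V₃) (edges g)) χ
        ≈⟨ ∑-attach-map (reattachEnd V₂ V₃) inj₂ (edges g) χ ⟨
      ∑ (attach (reattachEnd V₂ V₃) (edges g)) (λ es → χ (map (relabelEdge inj₂) es)) ∎

    distribute : ∀ es es′ → map (relabelEdge α) ((es ++ es′) ++ map (relabelEdge inj₂) es₃) ≡
      map (relabelEdge α) es ++ map (relabelEdge α) es′ ++ map (relabelEdge (inj₂ ∘ inj₂)) es₃
    distribute es es′ = ≡.trans (≡.cong (map (relabelEdge α)) (List.++-assoc es es′ _))
      (≡.trans (List.map-++ (relabelEdge α) es _)
        (≡.cong (map (relabelEdge α) es ++_)
          (≡.trans (List.map-++ (relabelEdge α) es′ _)
            (≡.cong (map (relabelEdge α) es′ ++_) (≡.sym (List.map-∘ es₃))))))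

    collect : ∀ (es : List (Edge ⟨ V₁ ⊕ (V₂ ⊕ V₃) ⟩)) es′ →
      es ++ map (relabelEdge inj₂) es′ ++ map (relabelEdge (inj₂ ∘ inj₂)) es₃ ≡
      es ++ map (relabelEdge inj₂) (es′ ++ map (relabelEdge inj₂) es₃)
    collect es es′ = ≡.cong (es ++_) (≡.sym (≡.trans (List.map-++ (relabelEdge inj₂) es′ _)
      (≡.cong (map (relabelEdge inj₂) es′ ++_) (≡.sym (List.map-∘ es₃)))))

  -- With one vertex to choose from, reattaching is a relabelling, and the edgeless graph adds
  -- nothing.
  ∑-compose-pointʳ : ∀ {V₁ V} v (v-only : IsOnlyElement V v) g {φ} → GraphInvariant (V₁ ⊕ V) φ →
    ∑ (compose V₁ V g (mkMultigraph [] v)) φ ≈ φ (relabel (≅-id ⊕-≅ point V v v-only) g)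
  ∑-compose-pointʳ {V₁} {V} v v-only g {φ} φ-inv = begin
    ∑ (compose V₁ V g (mkMultigraph [] v)) φ
      ≈⟨ ∑-compose V₁ V g (mkMultigraph [] v) φ ⟩
    ∑ (attach (reattachEnd V₁ V) (edges g)) (φ ∘ glue (mkMultigraph [] v))
      ≈⟨ ∑-attach-≐ {t = reattachEnd V₁ V} {[_] ∘ f} (reattachEnd-point V₁ V v v-only) (edges g) _ ⟩
    ∑ (attach ([_] ∘ f) (edges g)) (φ ∘ glue (mkMultigraph [] v))
      ≈⟨ ∑-attach-pure f (edges g) (φ ∘ glue (mkMultigraph [] v)) ⟩
    φ (glue (mkMultigraph [] v) (map (relabelEdge f) (edges g)))
      ≈⟨ φ-inv {glue (mkMultigraph [] v) (map (relabelEdge f) (edges g))} {relabel (≅-id ⊕-≅ point V v v-only) g}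
               (↭ᴱ-reflexive (List.++-identityʳ _)) ⟩
    φ (relabel (≅-id ⊕-≅ point V v v-only) g) ∎
    where f = to (≅-id {V₁} ⊕-≅ point V v v-only)

-- The axioms for linear combinations

module _ (K : HeytingField c ℓ ℓ₂) where
  private
    R = fieldRing K
  open CommutativeRing R hiding (zero)
  open Sums R
  open Species (MG K) using (Elem; act) renaming (_≈_ to _≈ᴹ_)
  open import Relation.Binary.Reasoning.Setoid setoid

  ∫-act : ∀ {V W} (σ : V ≅ W) (x : Elem V) φ → ∫ (act σ x) φ ≈ ∫ x (φ ∘ relabel σ)
  ∫-act σ x φ = ∫-map₂ (relabel σ) x φ

  ∫-comp : ∀ {V₁ V₂} (x : Elem (V₁ ⊕ 𝟙)) (y : Elem V₂) φ →
           ∫ (MG-comp K V₁ V₂ x y) φ ≈ ∫ x (λ g → ∫ y (λ h → ∑ (compose V₁ V₂ g h) φ))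
  ∫-comp {V₁} {V₂} x y φ =
    ∫-bilinear {multigraphs (V₁ ⊕ 𝟙)} {multigraphs V₂} {multigraphs (V₁ ⊕ V₂)} (compose V₁ V₂) x y φ

  ∫⇒≈ : ∀ {V} {x y : Elem V} → (∀ {φ} → GraphInvariant V φ → ∫ x φ ≈ ∫ y φ) → x ≈ᴹ y
  ∫⇒≈ {V} eq = Pairing.∫⇒≈ᶜ (multigraphs V) (λ φ φ-inv → eq φ-inv)

  MG-empty-zero : ∀ V → ¬ ⟨ V ⟩ → (x : Elem V) → x ≈ᴹ []
  -- Each coefficient is indexed by a multigraph, whose vertex witness contradicts emptiness; so
  -- there are no coefficients to compare.
  MG-empty-zero V ¬V x = FreeModule.by-coeff λ { (mkMultigraph _ v) → contradiction-irr v ¬V }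

  MG-comp-linearˡ : ∀ {V₁ V₂} (y : Elem V₂) →
    IsLinear (Species.obj (MG K) (V₁ ⊕ 𝟙)) (Species.obj (MG K) (V₁ ⊕ V₂)) (λ x → MG-comp K V₁ V₂ x y)
  MG-comp-linearˡ {V₁} {V₂} y = adjoint⇒linear (multigraphs (V₁ ⊕ 𝟙)) (multigraphs (V₁ ⊕ V₂))
    (λ x → MG-comp K V₁ V₂ x y)
    (λ φ g → ∫ y (λ h → ∑ (compose V₁ V₂ g h) φ))
    (λ φ-inv {g} {g′} g≈g′ → ∫-cong y (λ h → ∑-compose-congˡ h φ-inv {g} {g′} g≈g′))
    (λ x φ → ∫-comp x y φ)

  MG-comp-linearʳ : ∀ {V₁ V₂} (x : Elem (V₁ ⊕ 𝟙)) →
    IsLinear (Species.obj (MG K) V₂) (Species.obj (MG K) (V₁ ⊕ V₂)) (λ y → MG-comp K V₁ V₂ x y)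
  MG-comp-linearʳ {V₁} {V₂} x = adjoint⇒linear (multigraphs V₂) (multigraphs (V₁ ⊕ V₂))
    (λ y → MG-comp K V₁ V₂ x y)
    (λ φ h → ∫ x (λ g → ∑ (compose V₁ V₂ g h) φ))
    (λ φ-inv {h} {h′} h≈h′ → ∫-cong x (λ g → ∑-compose-congʳ g φ-inv {h} {h′} h≈h′))
    (λ y φ → trans (∫-comp x y φ) (∫-swap x y _))

  MG-comp-natural : ∀ {V₁ V₂ W₁ W₂} (σ : V₁ ≅ W₁) (τ : V₂ ≅ W₂) (x : Elem (V₁ ⊕ 𝟙)) (y : Elem V₂) →
    act (σ ⊕-≅ τ) (MG-comp K V₁ V₂ x y) ≈ᴹ MG-comp K W₁ W₂ (act (σ ⊕-≅ ≅-id) x) (act τ y)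
  MG-comp-natural {V₁} {V₂} {W₁} {W₂} σ τ x y = ∫⇒≈ λ {φ} φ-inv → begin
    ∫ (act (σ ⊕-≅ τ) (MG-comp K V₁ V₂ x y)) φ
      ≈⟨ ∫-act (σ ⊕-≅ τ) (MG-comp K V₁ V₂ x y) φ ⟩
    ∫ (MG-comp K V₁ V₂ x y) (φ ∘ relabel (σ ⊕-≅ τ))
      ≈⟨ ∫-comp x y _ ⟩
    ∫ x (λ g → ∫ y (λ h → ∑ (compose V₁ V₂ g h) (φ ∘ relabel (σ ⊕-≅ τ))))
      ≈⟨ ∫-cong x (λ g → ∫-cong y (λ h → ∑-compose-natural σ τ g h φ-inv)) ⟩
    ∫ x (λ g → ∫ y (λ h → ∑ (compose W₁ W₂ (relabel (σ ⊕-≅ ≅-id) g) (relabel τ h)) φ))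
      ≈⟨ ∫-cong x (λ g → ∫-act τ y _) ⟨
    ∫ x (λ g → ∫ (act τ y) (λ h → ∑ (compose W₁ W₂ (relabel (σ ⊕-≅ ≅-id) g) h) φ))
      ≈⟨ ∫-act (σ ⊕-≅ ≅-id) x _ ⟨
    ∫ (act (σ ⊕-≅ ≅-id) x) (λ g → ∫ (act τ y) (λ h → ∑ (compose W₁ W₂ g h) φ))
      ≈⟨ ∫-comp (act (σ ⊕-≅ ≅-id) x) (act τ y) φ ⟨
    ∫ (MG-comp K W₁ W₂ (act (σ ⊕-≅ ≅-id) x) (act τ y)) φ ∎

  -- Moves all three integrals outside the sums over graphs, so that both associativity axioms
  -- reduce to their versions for basis graphs under the integral signs.
  ∫-comp-act-comp : ∀ {U₁ U₂ V₁ V₂} (ρ : U₁ ⊕ U₂ ≅ V₁ ⊕ 𝟙) (x : Elem (U₁ ⊕ 𝟙)) (y : Elem U₂) (z : Elem V₂) φ →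
    ∫ (MG-comp K V₁ V₂ (act ρ (MG-comp K U₁ U₂ x y)) z) φ ≈
    ∫ x (λ f → ∫ y (λ g → ∫ z (λ h → ∑ (compose U₁ U₂ f g) (λ f′ → ∑ (compose V₁ V₂ (relabel ρ f′) h) φ))))
  ∫-comp-act-comp {U₁} {U₂} {V₁} {V₂} ρ x y z φ = begin
    ∫ (MG-comp K V₁ V₂ (act ρ (MG-comp K U₁ U₂ x y)) z) φ
      ≈⟨ ∫-comp (act ρ (MG-comp K U₁ U₂ x y)) z φ ⟩
    ∫ (act ρ (MG-comp K U₁ U₂ x y)) (λ f → ∫ z (λ h → ∑ (compose V₁ V₂ f h) φ))
      ≈⟨ ∫-act ρ (MG-comp K U₁ U₂ x y) _ ⟩
    ∫ (MG-comp K U₁ U₂ x y) (λ f → ∫ z (λ h → ∑ (compose V₁ V₂ (relabel ρ f) h) φ))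
      ≈⟨ ∫-comp x y _ ⟩
    ∫ x (λ f → ∫ y (λ g → ∑ (compose U₁ U₂ f g) (λ f′ → ∫ z (λ h → ∑ (compose V₁ V₂ (relabel ρ f′) h) φ))))
      ≈⟨ ∫-cong x (λ f → ∫-cong y (λ g → ∫-∑ z (compose U₁ U₂ f g) _)) ⟨
    ∫ x (λ f → ∫ y (λ g → ∫ z (λ h → ∑ (compose U₁ U₂ f g) (λ f′ → ∑ (compose V₁ V₂ (relabel ρ f′) h) φ)))) ∎

  MG-comp-parallel : ∀ {V₁ V₂ V₃} (x : Elem (V₁ ⊕ 𝟙 ⊕ 𝟙)) (y : Elem V₂) (z : Elem V₃) →
    MG-comp K (V₁ ⊕ V₂) V₃ (act (exchange V₁ 𝟙 V₂) (MG-comp K (V₁ ⊕ 𝟙) V₂ x y)) z ≈ᴹ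
    act (exchange V₁ V₃ V₂)
      (MG-comp K (V₁ ⊕ V₃) V₂
        (act (exchange V₁ 𝟙 V₃) (MG-comp K (V₁ ⊕ 𝟙) V₃ (act (exchange V₁ 𝟙 𝟙) x) z))
        y)
  MG-comp-parallel {V₁} {V₂} {V₃} x y z = ∫⇒≈ λ {φ} φ-inv → begin
    ∫ (MG-comp K (V₁ ⊕ V₂) V₃ (act (exchange V₁ 𝟙 V₂) (MG-comp K (V₁ ⊕ 𝟙) V₂ x y)) z) φ
      ≈⟨ ∫-comp-act-comp (exchange V₁ 𝟙 V₂) x y z φ ⟩
    ∫ x (λ f → ∫ y (λ g → ∫ z (λ h → ∑ (compose (V₁ ⊕ 𝟙) V₂ f g) (λ f′ →
      ∑ (compose (V₁ ⊕ V₂) V₃ (relabel (exchange V₁ 𝟙 V₂) f′) h) φ))))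
      ≈⟨ ∫-cong x (λ f → ∫-cong y (λ g → ∫-cong z (λ h → ∑-compose-parallel f g h φ-inv))) ⟩
    ∫ x (λ f → ∫ y (λ g → ∫ z (λ h → swapped φ (relabel (exchange V₁ 𝟙 𝟙) f) h g)))
      -- The right-hand side inserts `z` before `y`.
      ≈⟨ ∫-cong x (λ f → ∫-swap y z _) ⟩
    ∫ x (λ f → ∫ z (λ h → ∫ y (λ g → swapped φ (relabel (exchange V₁ 𝟙 𝟙) f) h g)))
      ≈⟨ ∫-act (exchange V₁ 𝟙 𝟙) x _ ⟨
    ∫ (act (exchange V₁ 𝟙 𝟙) x) (λ f → ∫ z (λ h → ∫ y (λ g → swapped φ f h g)))
      ≈⟨ ∫-comp-act-comp (exchange V₁ 𝟙 V₃) (act (exchange V₁ 𝟙 𝟙) x) z y _ ⟨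
    ∫ (MG-comp K (V₁ ⊕ V₃) V₂
        (act (exchange V₁ 𝟙 V₃) (MG-comp K (V₁ ⊕ 𝟙) V₃ (act (exchange V₁ 𝟙 𝟙) x) z)) y)
      (φ ∘ relabel (exchange V₁ V₃ V₂))
      ≈⟨ ∫-act (exchange V₁ V₃ V₂) (MG-comp K (V₁ ⊕ V₃) V₂
           (act (exchange V₁ 𝟙 V₃) (MG-comp K (V₁ ⊕ 𝟙) V₃ (act (exchange V₁ 𝟙 𝟙) x) z)) y) φ ⟨
    ∫ (act (exchange V₁ V₃ V₂) (MG-comp K (V₁ ⊕ V₃) V₂
        (act (exchange V₁ 𝟙 V₃) (MG-comp K (V₁ ⊕ 𝟙) V₃ (act (exchange V₁ 𝟙 𝟙) x) z)) y)) φ ∎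
    where
    swapped : (Multigraph (V₁ ⊕ V₂ ⊕ V₃) → Carrier) →
              Multigraph (V₁ ⊕ 𝟙 ⊕ 𝟙) → Multigraph V₃ → Multigraph V₂ → Carrier
    swapped φ f h g = ∑ (compose (V₁ ⊕ 𝟙) V₃ f h) (λ f′ →
      ∑ (compose (V₁ ⊕ V₃) V₂ (relabel (exchange V₁ 𝟙 V₃) f′) g) (φ ∘ relabel (exchange V₁ V₃ V₂)))

  MG-comp-sequential : ∀ {V₁ V₂ V₃} (x : Elem (V₁ ⊕ 𝟙)) (y : Elem (V₂ ⊕ 𝟙)) (z : Elem V₃) →
    act (assocʳ V₁ V₂ V₃)
      (MG-comp K (V₁ ⊕ V₂) V₃ (act (assocˡ V₁ V₂ 𝟙) (MG-comp K V₁ (V₂ ⊕ 𝟙) x y)) z) ≈ᴹ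
    MG-comp K V₁ (V₂ ⊕ V₃) x (MG-comp K V₂ V₃ y z)
  MG-comp-sequential {V₁} {V₂} {V₃} x y z = ∫⇒≈ λ {φ} φ-inv → begin
    ∫ (act (assocʳ V₁ V₂ V₃)
        (MG-comp K (V₁ ⊕ V₂) V₃ (act (assocˡ V₁ V₂ 𝟙) (MG-comp K V₁ (V₂ ⊕ 𝟙) x y)) z)) φ
      ≈⟨ ∫-act (assocʳ V₁ V₂ V₃)
           (MG-comp K (V₁ ⊕ V₂) V₃ (act (assocˡ V₁ V₂ 𝟙) (MG-comp K V₁ (V₂ ⊕ 𝟙) x y)) z) φ ⟩
    ∫ (MG-comp K (V₁ ⊕ V₂) V₃ (act (assocˡ V₁ V₂ 𝟙) (MG-comp K V₁ (V₂ ⊕ 𝟙) x y)) z)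
      (φ ∘ relabel (assocʳ V₁ V₂ V₃))
      ≈⟨ ∫-comp-act-comp (assocˡ V₁ V₂ 𝟙) x y z _ ⟩
    ∫ x (λ f → ∫ y (λ g → ∫ z (λ h → ∑ (compose V₁ (V₂ ⊕ 𝟙) f g) (λ f′ →
      ∑ (compose (V₁ ⊕ V₂) V₃ (relabel (assocˡ V₁ V₂ 𝟙) f′) h) (φ ∘ relabel (assocʳ V₁ V₂ V₃))))))
      ≈⟨ ∫-cong x (λ f → ∫-cong y (λ g → ∫-cong z (λ h → ∑-compose-sequential f g h φ-inv))) ⟩
    ∫ x (λ f → ∫ y (λ g → ∫ z (λ h → ∑ (compose V₂ V₃ g h) (λ g′ → ∑ (compose V₁ (V₂ ⊕ V₃) f g′) φ))))
      ≈⟨ ∫-cong x (λ f → ∫-comp y z _) ⟨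
    ∫ x (λ f → ∫ (MG-comp K V₂ V₃ y z) (λ g′ → ∑ (compose V₁ (V₂ ⊕ V₃) f g′) φ))
      ≈⟨ ∫-comp x (MG-comp K V₂ V₃ y z) φ ⟨
    ∫ (MG-comp K V₁ (V₂ ⊕ V₃) x (MG-comp K V₂ V₃ y z)) φ ∎

  MG-comp-unitʳ : ∀ {V₁ V} v (v-only : IsOnlyElement V v) (x : Elem (V₁ ⊕ 𝟙)) →
    MG-comp K V₁ V x (MG-unit K V v v-only) ≈ᴹ act (≅-id ⊕-≅ point V v v-only) x
  MG-comp-unitʳ {V₁} {V} v v-only x = ∫⇒≈ λ {φ} φ-inv → begin
    ∫ (MG-comp K V₁ V x (MG-unit K V v v-only)) φ
      ≈⟨ ∫-comp x (MG-unit K V v v-only) φ ⟩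
    ∫ x (λ g → ∫ (MG-unit K V v v-only) (λ h → ∑ (compose V₁ V g h) φ))
      ≈⟨ ∫-cong x (λ g → trans (+-identityʳ _) (trans (*-identityˡ _) (∑-compose-pointʳ v v-only g φ-inv))) ⟩
    ∫ x (φ ∘ relabel (≅-id ⊕-≅ point V v v-only))
      ≈⟨ ∫-act (≅-id ⊕-≅ point V v v-only) x φ ⟨
    ∫ (act (≅-id ⊕-≅ point V v v-only) x) φ ∎

  MG-comp-unitˡ : ∀ {V} *-only (x : Elem V) →
    MG-comp K ∅ V (MG-unit K (∅ ⊕ 𝟙) (inj₂ tt) *-only) x ≈ᴹ act (⊕-identityˡ⁻¹ V) x
  MG-comp-unitˡ {V} *-only x = ∫⇒≈ λ {φ} φ-inv → begin
    ∫ (MG-comp K ∅ V (MG-unit K (∅ ⊕ 𝟙) (inj₂ tt) *-only) x) φ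
      ≈⟨ ∫-comp (MG-unit K (∅ ⊕ 𝟙) (inj₂ tt) *-only) x φ ⟩
    ∫ (MG-unit K (∅ ⊕ 𝟙) (inj₂ tt) *-only) (λ g → ∫ x (λ h → ∑ (compose ∅ V g h) φ))
      ≈⟨ trans (+-identityʳ _) (*-identityˡ _) ⟩
    ∫ x (λ h → ∑ (compose ∅ V (mkMultigraph [] (inj₂ tt)) h) φ)
      -- The edgeless graph has no ends at the point, hence exactly one attachment, the empty one;
      -- gluing `h` to it is its relabelling by computation.
      ≈⟨ ∫-cong x (λ h → +-identityʳ _) ⟩
    ∫ x (φ ∘ relabel (⊕-identityˡ⁻¹ V))
      ≈⟨ ∫-act (⊕-identityˡ⁻¹ V) x φ ⟨
    ∫ (act (⊕-identityˡ⁻¹ V) x) φ ∎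

theorem2p2 : ∀ {c ℓ₁ ℓ₂} (K : HeytingField c ℓ₁ ℓ₂) → CharacteristicZero K →
    IsOperad (MG K) (MG-unit K) (MG-comp K)
theorem2p2 K _ = record
  { empty-zero      = MG-empty-zero K
  ; unit-natural    = λ {V} {W} σ v w v-only w-only →
      -- The vertex stored in an edgeless graph is irrelevant, so both pairings are equal by
      -- computation.
      ∫⇒≈ K {x = Species.act (MG K) σ (MG-unit K V v v-only)} {MG-unit K W w w-only} λ _ → CommutativeRing.refl (fieldRing K)
  ; comp-linearˡ    = MG-comp-linearˡ K
  ; comp-linearʳ    = MG-comp-linearʳ K
  ; comp-natural    = MG-comp-natural K
  ; comp-parallel   = MG-comp-parallel K
  ; comp-sequential = MG-comp-sequential K
  ; comp-unitʳ      = MG-comp-unitʳ K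
  ; comp-unitˡ      = MG-comp-unitˡ K
  }
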